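{- Let $m,u\ge 2$ and $n,v\ge 0$ be integers. For integers $N,M,j\ge 0$ let $\mathcal{A}(N,M,j)$ denote the set of all $N$-tuples $(a_1,\dots,a_N)$ of positive integers with $a_1+\dots+a_N=M$ and such that exactly $j$ of the entries $a_s$ are even. Then $$ \begin{aligned} &\zeta^t(m,\{1\}^n)\,\zeta^t(u,\{1\}^v)\\ ={}&\sum_{l=1}^{n}\ \sum_{k=0}^{\min\{v,n-l\}}\ \sum_{\substack{i+j=k\\ i,j\ge 0}}\ \sum_{(a_1,\dots,a_N)\in\mathcal{A}(N,\,n+v-l,\,j)} \binom{v+n-l-2k}{v-k}(t^2-t)^i(1-2t)^j\\ &\quad\times\Big[\zeta^t(m,\{1\}^l,u,a_1,\dots,a_N)+(1-2t)\zeta^t(m,\{1\}^{l-1},u+1,a_1,\dots,a_N)\\ &\qquad\ +(1-\delta_{v,0}\delta_{n,l})(t^2-t)\zeta^t(m,\{1\}^{l-1},u+1+a_1,a_2,\dots,a_N)\Big]\\ &+\sum_{l=1}^{v}\ \sum_{k=0}^{\min\{n,v-l\}}\ \sum_{\substack{i+j=k\\ i,j\ge 0}}\ \sum_{(a_1,\dots,a_N)\in\mathcal{A}(N,\,n+v-l,\,j)} \binom{v+n-l-2k}{n-k}(t^2-t)^i(1-2t)^j\\ &\quad\times\Big[\zeta^t(u,\{1\}^l,m,a_1,\dots,a_N)+(1-2t)\zeta^t(u,\{1\}^{l-1},m+1,a_1,\dots,a_N)\\ &\qquad\ +(1-\delta_{n,0}\delta_{v,l})(t^2-t)\zeta^t(u,\{1\}^{l-1},m+1+a_1,a_2,\dots,a_N)\Big]\\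 &+\sum_{k=0}^{\min\{n,v\}}\ \sum_{\substack{i+j=k\\ i,j\ge 0}}\ \sum_{(a_1,\dots,a_{N'})\in\mathcal{A}(N',\,n+v,\,j)} \binom{v+n-2k}{n-k}(t^2-t)^i(1-2t)^j\\ &\quad\times\Big[\zeta^t(m,u,a_1,\dots,a_{N'})+\zeta^t(u,m,a_1,\dots,a_{N'})+(1-2t)\zeta^t(m+u,a_1,\dots,a_{N'})\\ &\qquad\ +(1-\delta_{n,0}\delta_{v,0})(t^2-t)\zeta^t(m+u+a_1,a_2,\dots,a_{N'})\Big], \end{aligned} $$ where $N=v+n-l-i-k$ in the first two sums and $N'=v+n-i-k$ in the third.
   Context: For positive integers $k_1,\dots,k_n$ with $k_1\ge 2$ (an admissible index), the multiple zeta value is $\zeta(k_1,\dots,k_n)=\sum_{m_1>\cdots>m_n\ge 1}\frac{1}{m_1^{k_1}\cdots m_n^{k_n}}$, and the interpolated multiple zeta value is the polynomial $$\zeta^t(k_1,\dots,k_n)=\sum_{\mathbf p}t^{\,n-\mathrm{dep}(\mathbf p)}\zeta(\mathbf p)\in\mathbb{R}[t],$$ where $\mathbf p$ runs over the $2^{n-1}$ indices $(k_1\Box k_2\Box\cdots\Box k_n)$ obtained by replacing each $\Box$ by either a comma or a plus sign, and $\mathrm{dep}(\mathbf p)$ is the number of entries of $\mathbf p$. $\{1\}^l$ denotes $1$ repeated $l$ times (omitted if $l=0$); $\delta_{i,j}$ is Kronecker's delta. Empty sums are $0$; $\mathcal{A}(0,0,0)$ consists of the empty tuple and $\mathcal{A}(0,M,j)$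 is empty for $(M,j)\ne(0,0)$. A term involving $a_1$ when there is no $a_1$ (empty tuple) occurs only with coefficient $1-\delta\delta=0$ and is read as $0$. -}

module Defs where

open import Algebra.Bundles.Raw using (RawRing)
import Algebra.Definitions.RawSemiring as RawSemiringDefs
open import Data.Bool.Base using (if_then_else_)
open import Data.Integer.Base as ℤ using (+_; -[1+_])
import Data.Integer.Properties as ℤ
open import Data.Irrelevant using ([_])
open import Data.List.Base as List using (List; []; _∷_; _++_; length; replicate; upTo; filter; cartesianProductWith)
open import Data.List.Relation.Unary.All using (All; []; _∷_)
open import Data.Nat.Base as ℕ using (ℕ; zero; suc; _⊔_; z≤n; s≤s)
open import Data.Nat.Divisibility using (_∣?_)
import Data.Nat.Properties as ℕ
open import Data.Product.Base using (∃; _×_; _,_)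
open import Data.Rational.Base hiding (_⊔_; truncate)
open import Data.Rational.Properties
open import Data.Rational.Solver using (module +-*-Solver)
import Data.Rational.Unnormalised.Base as ℚᵘ
import Data.Rational.Unnormalised.Properties as ℚᵘ
open import Data.Refinement using (Refinement-syntax; _,_; value)
open import Data.Sum.Base using ([_,_]′)
open import Data.Vec.Base as Vec using (Vec)
open import Relation.Binary.PropositionalEquality using (_≡_; refl; sym; trans; cong; cong₂; subst; subst₂; module ≡-Reasoning)
open import Relation.Nullary.Decidable using (recompute; does; _×-dec_)

private
  module Ordering where

    open +-*-Solver

    0≤diff⇒≤ : ∀ {p q} → 0ℚ ≤ q - p → p ≤ q
    0≤diff⇒≤ {p} {q} h = subst₂ _≤_ (+-identityʳ p)
      (solve 2 (λ p q → p :+ (q :- p) := q) refl p q) (+-monoʳ-≤ p h)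

    ≤⇒0≤diff : ∀ {p q} → p ≤ q → 0ℚ ≤ q - p
    ≤⇒0≤diff {p} {q} h = subst (_≤ q - p) (+-inverseʳ p) (+-monoˡ-≤ (- p) h)

    0≤+ : ∀ {p q} → 0ℚ ≤ p → 0ℚ ≤ q → 0ℚ ≤ p + q
    0≤+ = +-mono-≤

    *-monoˡ-≤ : ∀ {p q r} → 0ℚ ≤ r → p ≤ q → r * p ≤ r * q
    *-monoˡ-≤ {r = r} 0≤r = *-monoˡ-≤-nonNeg r {{nonNegative 0≤r}}

    *-monoʳ-≤ : ∀ {p q r} → 0ℚ ≤ r → p ≤ q → p * r ≤ q * r
    *-monoʳ-≤ {r = r} 0≤r = *-monoʳ-≤-nonNeg r {{nonNegative 0≤r}}

    0≤* : ∀ {p q} → 0ℚ ≤ p → 0ℚ ≤ q → 0ℚ ≤ p * q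
    0≤* {p} {q} 0≤p 0≤q = subst (_≤ p * q) (*-zeroʳ p) (*-monoˡ-≤ 0≤p 0≤q)

    0<* : ∀ {p q} → 0ℚ < p → 0ℚ < q → 0ℚ < p * q
    0<* {p} {q} 0<p 0<q =
      positive⁻¹ (p * q) {{pos*pos⇒pos p {{positive 0<p}} q {{positive 0<q}}}}

    reciprocal : ∀ {p} → 0ℚ < p → ∃ λ q → 0ℚ < q × p * q ≡ 1ℚ
    reciprocal {p} 0<p =
      let instance
            p>0 = positive 0<p
            p≢0 = pos⇒nonZero p
      in 1/ p , positive⁻¹ (1/ p) {{1/pos⇒pos p}} , *-inverseʳ p

    p≡[p-q]+q : ∀ p q → p ≡ (p - q) + q
    p≡[p-q]+q = solve 2 (λ p q → p := (p :- q) :+ q) refl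

    p≤p+q : ∀ {p q} → 0ℚ ≤ q → p ≤ p + q
    p≤p+q {p} {q} 0≤q = subst (_≤ p + q) (+-identityʳ p) (+-monoʳ-≤ p 0≤q)

    p-q≤p : ∀ {p q} → 0ℚ ≤ q → p - q ≤ p
    p-q≤p {p} {q} 0≤q =
      subst (p - q ≤_) (+-identityʳ p) (+-monoʳ-≤ p (neg-antimono-≤ 0≤q))

    *-left-comm : ∀ p q r → p * (q * r) ≡ q * (p * r)
    *-left-comm = solve 3 (λ p q r → p :* (q :* r) := q :* (p :* r)) refl

    0<½ : 0ℚ < ½
    0<½ = positive⁻¹ ½

    half : ℚ → ℚ
    half ε = ½ * ε

    0<half : ∀ {ε} → 0ℚ < ε → 0ℚ < half ε
    0<half = 0<* 0<½

    half+half : ∀ ε → half ε + half ε ≡ ε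
    half+half = solve 1 (λ ε → con ½ :* ε :+ con ½ :* ε := ε) refl

    ∣-∣-swap : ∀ p q → ∣ p - q ∣ ≡ ∣ q - p ∣
    ∣-∣-swap p q = trans (sym (∣-p∣≡∣p∣ (p - q)))
      (cong ∣_∣ (solve 2 (λ p q → :- (p :- q) := q :- p) refl p q))

    ∣sum-diff∣ : ∀ x₁ x₂ y₁ y₂ → ∣ (x₁ + y₁) - (x₂ + y₂) ∣ ≤ ∣ x₁ - x₂ ∣ + ∣ y₁ - y₂ ∣
    ∣sum-diff∣ x₁ x₂ y₁ y₂ = subst (λ z → ∣ z ∣ ≤ ∣ x₁ - x₂ ∣ + ∣ y₁ - y₂ ∣)
      (solve 4 (λ x₁ x₂ y₁ y₂ → (x₁ :- x₂) :+ (y₁ :- y₂) := (x₁ :+ y₁) :- (x₂ :+ y₂)) refl x₁ x₂ y₁ y₂)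
      (∣p+q∣≤∣p∣+∣q∣ (x₁ - x₂) (y₁ - y₂))

    ∣neg-diff∣ : ∀ p q → ∣ (- p) - (- q) ∣ ≡ ∣ p - q ∣
    ∣neg-diff∣ p q = trans
      (cong ∣_∣ (solve 2 (λ p q → :- p :- (:- q) := :- (p :- q)) refl p q)) (∣-p∣≡∣p∣ (p - q))

    ∣product-diff∣ : ∀ {B C} x₁ x₂ y₁ y₂ → ∣ x₁ ∣ ≤ B → ∣ y₂ ∣ ≤ C →
                    ∣ x₁ * y₁ - x₂ * y₂ ∣ ≤ B * ∣ y₁ - y₂ ∣ + C * ∣ x₁ - x₂ ∣
    ∣product-diff∣ {B} {C} x₁ x₂ y₁ y₂ x₁≤B y₂≤C = begin
      ∣ x₁ * y₁ - x₂ * y₂ ∣                        ≡⟨ cong ∣_∣ identity ⟩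
      ∣ x₁ * (y₁ - y₂) + y₂ * (x₁ - x₂) ∣          ≤⟨ ∣p+q∣≤∣p∣+∣q∣ (x₁ * (y₁ - y₂)) (y₂ * (x₁ - x₂)) ⟩
      ∣ x₁ * (y₁ - y₂) ∣ + ∣ y₂ * (x₁ - x₂) ∣      ≡⟨ cong₂ _+_ (∣p*q∣≡∣p∣*∣q∣ x₁ (y₁ - y₂)) (∣p*q∣≡∣p∣*∣q∣ y₂ (x₁ - x₂)) ⟩
      ∣ x₁ ∣ * ∣ y₁ - y₂ ∣ + ∣ y₂ ∣ * ∣ x₁ - x₂ ∣  ≤⟨ +-mono-≤ (*-monoʳ-≤ (0≤∣p∣ (y₁ - y₂)) x₁≤B) (*-monoʳ-≤ (0≤∣p∣ (x₁ - x₂)) y₂≤C) ⟩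
      B * ∣ y₁ - y₂ ∣ + C * ∣ x₁ - x₂ ∣            ∎
      where
      open ≤-Reasoning
      identity : x₁ * y₁ - x₂ * y₂ ≡ x₁ * (y₁ - y₂) + y₂ * (x₁ - x₂)
      identity = solve 4 (λ x₁ x₂ y₁ y₂ → x₁ :* y₁ :- x₂ :* y₂ := x₁ :* (y₁ :- y₂) :+ y₂ :* (x₁ :- x₂)) refl x₁ x₂ y₁ y₂

    scale-< : ∀ {B b d e} → 0ℚ < B → B * b ≡ 1ℚ → d < b * e → B * d < e
    scale-< {B} {b} {d} {e} 0<B Bb≡1 d<be = begin-strict
      B * d          <⟨ *-monoʳ-<-pos B {{positive 0<B}} d<be ⟩
      B * (b * e)    ≡⟨ sym (*-assoc B b e) ⟩
      (B * b) * e    ≡⟨ cong (_* e) Bb≡1 ⟩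
      1ℚ * e         ≡⟨ *-identityˡ e ⟩
      e              ∎
      where open ≤-Reasoning

    ∣-∣-bound : ∀ {ε} p q → 0ℚ < ε → q ≤ p → p ≤ q + half ε → ∣ p - q ∣ < ε
    ∣-∣-bound {ε} p q 0<ε q≤p p≤q+ε = begin-strict
      ∣ p - q ∣          ≡⟨ 0≤p⇒∣p∣≡p (≤⇒0≤diff q≤p) ⟩
      p - q              ≤⟨ +-monoˡ-≤ (- q) p≤q+ε ⟩
      q + half ε - q     ≡⟨ solve 2 (λ q e → q :+ e :- q := con 0ℚ :+ e) refl q (half ε) ⟩
      0ℚ + half ε        <⟨ +-monoˡ-< (half ε) (0<half 0<ε) ⟩
      half ε + half ε    ≡⟨ half+half ε ⟩
      ε                  ∎
      where open ≤-Reasoning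

    antitone : ∀ (D : ℕ → ℚ) N → (∀ n → N ℕ.≤ n → D (suc n) ≤ D n) →
               ∀ {p q} → N ℕ.≤ p → p ℕ.≤ q → D q ≤ D p
    antitone D N step {p} N≤p p≤q = go (ℕ.≤⇒≤′ p≤q)
      where
      go : ∀ {q} → p ℕ.≤′ q → D q ≤ D p
      go ℕ.≤′-refl = ≤-refl
      go (ℕ.≤′-step p≤′q) =
        ≤-trans (step _ (ℕ.≤-trans N≤p (ℕ.≤′⇒≤ p≤′q))) (go p≤′q)

  open Ordering

-- Real numbers: Cauchy sequences of rationals, two of which are identified
-- (by _≈ᵣ_) when their difference tends to 0.

record ℝ : Set where
  field
    approx : ℕ → ℚ
    cauchy : ∀ ε → 0ℚ < ε → ∃ λ N → ∀ p q → N ℕ.≤ p → N ℕ.≤ q → ∣ approx p - approx q ∣ < ε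

open ℝ public

infix  4 _≈ᵣ_
infixl 6 _+ᵣ_
infixl 7 _*ᵣ_
infix  8 -ᵣ_

_≈ᵣ_ : ℝ → ℝ → Set
x ≈ᵣ y = ∀ ε → 0ℚ < ε → ∃ λ N → ∀ p → N ℕ.≤ p → ∣ approx x p - approx y p ∣ < ε

constᵣ : ℚ → ℝ
constᵣ c .approx _ = c
constᵣ c .cauchy ε 0<ε = 0 , λ _ _ _ _ → subst (_< ε) (cong ∣_∣ (sym (+-inverseʳ c))) 0<ε

private
  bounded : ∀ x → ∃ λ B → 0ℚ < B × ∃ λ N → ∀ p → N ℕ.≤ p → ∣ approx x p ∣ ≤ B
  bounded x with cauchy x 1ℚ (positive⁻¹ 1ℚ)
  ... | N , close = 1ℚ + ∣ approx x N ∣ , +-mono-<-≤ (positive⁻¹ 1ℚ) (0≤∣p∣ (approx x N)) , N , λ p N≤p →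
    begin
      ∣ approx x p ∣                               ≡⟨ cong ∣_∣ (p≡[p-q]+q (approx x p) (approx x N)) ⟩
      ∣ approx x p - approx x N + approx x N ∣     ≤⟨ ∣p+q∣≤∣p∣+∣q∣ (approx x p - approx x N) (approx x N) ⟩
      ∣ approx x p - approx x N ∣ + ∣ approx x N ∣ ≤⟨ +-monoˡ-≤ ∣ approx x N ∣ (<⇒≤ (close p N N≤p ℕ.≤-refl)) ⟩
      1ℚ + ∣ approx x N ∣                          ∎
    where open ≤-Reasoning

_+ᵣ_ : ℝ → ℝ → ℝ
(x +ᵣ y) .approx p = approx x p + approx y p
(x +ᵣ y) .cauchy ε 0<ε with cauchy x (half ε) (0<half 0<ε) | cauchy y (half ε) (0<half 0<ε)
... | N₁ , close₁ | N₂ , close₂ = N₁ ⊔ N₂ , λ p q N≤p N≤q →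
  subst (_ <_) (half+half ε) (≤-<-trans
    (∣sum-diff∣ (approx x p) (approx x q) (approx y p) (approx y q))
    (+-mono-< (close₁ p q (ℕ.m⊔n≤o⇒m≤o N₁ N₂ N≤p) (ℕ.m⊔n≤o⇒m≤o N₁ N₂ N≤q))
              (close₂ p q (ℕ.m⊔n≤o⇒n≤o N₁ N₂ N≤p) (ℕ.m⊔n≤o⇒n≤o N₁ N₂ N≤q))))

-ᵣ_ : ℝ → ℝ
(-ᵣ x) .approx p = - approx x p
(-ᵣ x) .cauchy ε 0<ε with cauchy x ε 0<ε
... | N , close = N , λ p q N≤p N≤q →
  subst (_< ε) (sym (∣neg-diff∣ (approx x p) (approx x q))) (close p q N≤p N≤q)

private
  product-cauchy : ∀ (x y : ℝ) ε → 0ℚ < ε → ∃ λ N → ∀ p q → N ℕ.≤ p → N ℕ.≤ q →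
                   ∣ approx x p * approx y p - approx x q * approx y q ∣ < ε
  product-cauchy x y ε 0<ε =
    let B , 0<B , N₁ , x≤B = bounded x
        C , 0<C , N₂ , y≤C = bounded y
        b , 0<b , Bb≡1     = reciprocal 0<B
        c , 0<c , Cc≡1     = reciprocal 0<C
        N₃ , close₁        = cauchy x (c * half ε) (0<* 0<c (0<half 0<ε))
        N₄ , close₂        = cauchy y (b * half ε) (0<* 0<b (0<half 0<ε))
        open Thresholds N₁ N₂ N₃ N₄
    in N , λ p q N≤p N≤q → subst (_ <_) (half+half ε) (≤-<-trans
      (∣product-diff∣ {B} {C} (approx x p) (approx x q) (approx y p) (approx y q) (x≤B p (N₁≤ N≤p)) (y≤C q (N₂≤ N≤q)))
      (+-mono-< (scale-< {B} {b} {e = half ε} 0<B Bb≡1 (close₂ p q (N₄≤ N≤p) (N₄≤ N≤q)))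
                (scale-< {C} {c} {e = half ε} 0<C Cc≡1 (close₁ p q (N₃≤ N≤p) (N₃≤ N≤q)))))
    where
    module Thresholds (N₁ N₂ N₃ N₄ : ℕ) where
      N = (N₁ ⊔ N₂) ⊔ (N₃ ⊔ N₄)
      N₁≤ : ∀ {p} → N ℕ.≤ p → N₁ ℕ.≤ p
      N₁≤ h = ℕ.m⊔n≤o⇒m≤o N₁ N₂ (ℕ.m⊔n≤o⇒m≤o (N₁ ⊔ N₂) (N₃ ⊔ N₄) h)
      N₂≤ : ∀ {p} → N ℕ.≤ p → N₂ ℕ.≤ p
      N₂≤ h = ℕ.m⊔n≤o⇒n≤o N₁ N₂ (ℕ.m⊔n≤o⇒m≤o (N₁ ⊔ N₂) (N₃ ⊔ N₄) h)
      N₃≤ : ∀ {p} → N ℕ.≤ p → N₃ ℕ.≤ p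
      N₃≤ h = ℕ.m⊔n≤o⇒m≤o N₃ N₄ (ℕ.m⊔n≤o⇒n≤o (N₁ ⊔ N₂) (N₃ ⊔ N₄) h)
      N₄≤ : ∀ {p} → N ℕ.≤ p → N₄ ℕ.≤ p
      N₄≤ h = ℕ.m⊔n≤o⇒n≤o N₃ N₄ (ℕ.m⊔n≤o⇒n≤o (N₁ ⊔ N₂) (N₃ ⊔ N₄) h)

_*ᵣ_ : ℝ → ℝ → ℝ
(x *ᵣ y) .approx p = approx x p * approx y p
(x *ᵣ y) .cauchy = product-cauchy x y

ℝ-rawRing : RawRing _ _
ℝ-rawRing = record
  { Carrier = ℝ
  ; _≈_     = _≈ᵣ_
  ; _+_     = _+ᵣ_
  ; _*_     = _*ᵣ_
  ; -_      = -ᵣ_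
  ; 0#      = constᵣ 0ℚ
  ; 1#      = constᵣ 1ℚ
  }

-- Polynomials in one variable, as lists of coefficients in increasing
-- degree; trailing zeros are immaterial up to _≈_.

module Polynomial {c ℓ} (R : RawRing c ℓ) where

  private module R = RawRing R

  Poly : Set c
  Poly = List R.Carrier

  coeff : Poly → ℕ → R.Carrier
  coeff []      _       = R.0#
  coeff (a ∷ p) zero    = a
  coeff (a ∷ p) (suc i) = coeff p i

  constant : R.Carrier → Poly
  constant a = a ∷ []

  variableₚ : Poly
  variableₚ = R.0# ∷ R.1# ∷ []

  add : Poly → Poly → Poly
  add []      q       = q
  add (a ∷ p) []      = a ∷ p
  add (a ∷ p) (b ∷ q) = (a R.+ b) ∷ add p q

  mul : Poly → Poly → Poly
  mul []      q = []
  mul (a ∷ p) q = add (List.map (a R.*_) q) (R.0# ∷ mul p q)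

  Poly-rawRing : RawRing c ℓ
  Poly-rawRing = record
    { Carrier = Poly
    ; _≈_     = λ p q → ∀ i → coeff p i R.≈ coeff q i
    ; _+_     = add
    ; _*_     = mul
    ; -_      = List.map R.-_
    ; 0#      = []
    ; 1#      = constant R.1#
    }

open Polynomial ℝ-rawRing public using (constant; coeff) renaming (Poly-rawRing to ℝ[t]; variableₚ to t)

open RawRing ℝ[t] public using () renaming
  ( Carrier to Pol
  ; _≈_ to infix 4 _≈ₚ_
  ; _+_ to infixl 6 _+ₚ_
  ; _*_ to infixl 7 _*ₚ_
  ; -_ to infix 8 -ₚ_
  ; 0# to 0ₚ
  ; 1# to 1ₚ
  )

-- n ×ₚ p is the n-fold sum p + ⋯ + p.
open RawSemiringDefs (RawRing.rawSemiring ℝ[t]) public using () renaming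
  ( _×_ to infixr 8 _×ₚ_
  ; _^_ to infixr 8 _^ₚ_
  )

infixl 6 _-ₚ_
_-ₚ_ : Pol → Pol → Pol
p -ₚ q = p +ₚ (-ₚ q)

∑ : ∀ {a} {A : Set a} → List A → (A → Pol) → Pol
∑ xs f = List.foldr (λ x s → f x +ₚ s) 0ₚ xs

infix 5 ∑
syntax ∑ xs (λ x → p) = ∑[ x ← xs ] p

-- The integers from a to b, none if b < a.
infix 6 _⋯_
_⋯_ : ℕ → ℕ → List ℕ
a ⋯ b = List.map (a ℕ.+_) (upTo (suc b ℕ.∸ a))

decompositions : ℕ → List (ℕ × ℕ)
decompositions k = List.map (λ i → i , k ℕ.∸ i) (0 ⋯ k)

δ : ℕ → ℕ → Pol
δ i j = if does (i ℕ.≟ j) then 1ₚ else 0ₚ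

ℕ≥ : ℕ → Set
ℕ≥ b = [ k ∈ ℕ ∣ b ℕ.≤ k ]

-- Admissible indices (k₁, …, kₙ), n ≥ 1.
Index : Set
Index = ℕ≥ 2 × List (ℕ≥ 1)

infixl 6 _⊕_
_⊕_ : ∀ {b} → ℕ≥ b → ℕ → ℕ≥ b
(k , [ b≤k ]) ⊕ i = k ℕ.+ i , [ ℕ.≤-trans b≤k (ℕ.m≤m+n k i) ]

↓_ : ℕ≥ 2 → ℕ≥ 1
↓ (k , [ 2≤k ]) = k , [ ℕ.<⇒≤ 2≤k ]

ones : ℕ → List (ℕ≥ 1)
ones l = replicate l (1 , [ s≤s z≤n ])

private
  bound : ∀ {b} (k : ℕ≥ b) → b ℕ.≤ value k
  bound {b} (k , [ b≤k ]) = recompute (b ℕ.≤? k) b≤k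

  bounds : ∀ (ks : List (ℕ≥ 1)) → All (1 ℕ.≤_) (List.map value ks)
  bounds []       = []
  bounds (k ∷ ks) = bound k ∷ bounds ks

open RawSemiringDefs +-*-rawSemiring using (_^_)

-- partialSum (k₁ ∷ ⋯ ∷ kₙ ∷ []) M is the sum of m₁^(-k₁)⋯mₙ^(-kₙ) over
-- M ≥ m₁ > ⋯ > mₙ ≥ 1.
partialSum : List ℕ → ℕ → ℚ
partialSum []       M       = 1ℚ
partialSum (k ∷ ks) zero    = 0ℚ
partialSum (k ∷ ks) (suc M) = partialSum (k ∷ ks) M + (+ 1 / suc M) ^ k * partialSum ks M

private
  module Convergence where

    open +-*-Solver

    r : ℕ → ℚ
    r n = + 1 / suc n

    ι : ℕ → ℚ
    ι n = + n / 1

    ι-suc : ∀ n → ι (suc n) ≡ 1ℚ + ι n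
    ι-suc n = toℚᵘ-injective (begin
      toℚᵘ (ι (suc n))                      ≈⟨ toℚᵘ-fromℚᵘ (ℚᵘ.mkℚᵘ (+ suc n) 0) ⟩
      ℚᵘ.mkℚᵘ (+ suc n) 0                    ≈⟨ ℚᵘ.*≡* (cong (λ z → (+ 1 ℤ.+ z) ℤ.* + 1) (sym (ℤ.*-identityʳ (+ n)))) ⟩
      ℚᵘ.1ℚᵘ ℚᵘ.+ ℚᵘ.mkℚᵘ (+ n) 0            ≈⟨ ℚᵘ.+-cong ℚᵘ.≃-refl (ℚᵘ.≃-sym (toℚᵘ-fromℚᵘ (ℚᵘ.mkℚᵘ (+ n) 0))) ⟩
      toℚᵘ 1ℚ ℚᵘ.+ toℚᵘ (ι n)               ≈⟨ ℚᵘ.≃-sym (toℚᵘ-homo-+ 1ℚ (ι n)) ⟩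
      toℚᵘ (1ℚ + ι n)                       ∎)
      where open ℚᵘ.≃-Reasoning

    r*ι : ∀ n → r n * ι (suc n) ≡ 1ℚ
    r*ι n = toℚᵘ-injective (begin
      toℚᵘ (r n * ι (suc n))                        ≈⟨ toℚᵘ-homo-* (r n) (ι (suc n)) ⟩
      toℚᵘ (r n) ℚᵘ.* toℚᵘ (ι (suc n))              ≈⟨ ℚᵘ.*-cong (toℚᵘ-fromℚᵘ (ℚᵘ.mkℚᵘ (+ 1) n)) (toℚᵘ-fromℚᵘ (ℚᵘ.mkℚᵘ (+ suc n) 0)) ⟩
      ℚᵘ.mkℚᵘ (+ 1) n ℚᵘ.* ℚᵘ.mkℚᵘ (+ suc n) 0       ≈⟨ ℚᵘ.*≡* (cong +_ (lemma n)) ⟩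
      ℚᵘ.1ℚᵘ                                        ∎)
      where
      open ℚᵘ.≃-Reasoning
      lemma : ∀ n → (1 ℕ.* suc n) ℕ.* 1 ≡ 1 ℕ.* (suc n ℕ.* 1)
      lemma n = ℕ.*-assoc 1 (suc n) 1

    ι-mono : ∀ {m n} → m ℕ.≤ n → ι m ≤ ι n
    ι-mono {m} {n} m≤n = toℚᵘ-cancel-≤ (begin
      toℚᵘ (ι m)        ≃⟨ toℚᵘ-fromℚᵘ (ℚᵘ.mkℚᵘ (+ m) 0) ⟩
      ℚᵘ.mkℚᵘ (+ m) 0    ≤⟨ ℚᵘ.*≤* (ℤ.*-monoʳ-≤-nonNeg (+ 1) (ℤ.+≤+ m≤n)) ⟩
      ℚᵘ.mkℚᵘ (+ n) 0    ≃⟨ ℚᵘ.≃-sym (toℚᵘ-fromℚᵘ (ℚᵘ.mkℚᵘ (+ n) 0)) ⟩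
      toℚᵘ (ι n)        ∎)
      where open ℚᵘ.≤-Reasoning

    0≤ι : ∀ n → 0ℚ ≤ ι n
    0≤ι n = ι-mono {0} {n} z≤n

    archimedean : ∀ p → ∃ λ N → p ≤ ι N
    archimedean (mkℚ -[1+ n ] d c) = 0 , *≤* ℤ.-≤+
    archimedean p@(mkℚ (+ n) d c) = n , toℚᵘ-cancel-≤ (begin
      ℚᵘ.mkℚᵘ (+ n) d    ≤⟨ ℚᵘ.*≤* (ℤ.*-monoˡ-≤-nonNeg (+ n) (ℤ.+≤+ (s≤s z≤n))) ⟩
      ℚᵘ.mkℚᵘ (+ n) 0    ≃⟨ ℚᵘ.≃-sym (toℚᵘ-fromℚᵘ (ℚᵘ.mkℚᵘ (+ n) 0)) ⟩
      toℚᵘ (ι n)        ∎)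
      where open ℚᵘ.≤-Reasoning

    0≤r : ∀ n → 0ℚ ≤ r n
    0≤r n = nonNegative⁻¹ (r n) {{normalize-nonNeg 1 (suc n)}}

    r-step : ∀ n → r (suc n) + r n * r (suc n) ≡ r n
    r-step n = lemma {r (suc n)} {r n} {ι (suc n)} (r*ι n) (trans (cong (r (suc n) *_) (sym (ι-suc (suc n)))) (r*ι (suc n)))
      where
      lemma : ∀ {x y s} → y * s ≡ 1ℚ → x * (1ℚ + s) ≡ 1ℚ → x + y * x ≡ y
      lemma {x} {y} {s} ys≡1 x+xs≡1 = begin
        x + y * x               ≡⟨ cong (_+ y * x) (sym (*-identityʳ x)) ⟩
        x * 1ℚ + y * x          ≡⟨ cong (λ z → x * z + y * x) (sym ys≡1) ⟩
        x * (y * s) + y * x     ≡⟨ solve 3 (λ x y s → x :* (y :* s) :+ y :* x := y :* (x :* (con 1ℚ :+ s))) refl x y s ⟩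
        y * (x * (1ℚ + s))      ≡⟨ cong (y *_) x+xs≡1 ⟩
        y * 1ℚ                  ≡⟨ *-identityʳ y ⟩
        y                       ∎
        where open ≡-Reasoning

    r≤1 : ∀ n → r n ≤ 1ℚ
    r≤1 n = begin
      r n                ≡⟨ sym (*-identityʳ (r n)) ⟩
      r n * ι 1          ≤⟨ *-monoˡ-≤ (0≤r n) (ι-mono {1} {suc n} (s≤s z≤n)) ⟩
      r n * ι (suc n)    ≡⟨ r*ι n ⟩
      1ℚ                 ∎
      where open ≤-Reasoning

    0≤^ : ∀ {x} k → 0ℚ ≤ x → 0ℚ ≤ x ^ k
    0≤^ zero    _   = nonNegative⁻¹ 1ℚ
    0≤^ (suc k) 0≤x = 0≤* 0≤x (0≤^ k 0≤x)

    ^≤1 : ∀ {x} k → 0ℚ ≤ x → x ≤ 1ℚ → x ^ k ≤ 1ℚ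
    ^≤1 zero    _   _   = ≤-refl
    ^≤1 {x} (suc k) 0≤x x≤1 = begin
      x * x ^ k    ≤⟨ *-monoˡ-≤ 0≤x (^≤1 k 0≤x x≤1) ⟩
      x * 1ℚ       ≡⟨ *-identityʳ x ⟩
      x            ≤⟨ x≤1 ⟩
      1ℚ           ∎
      where open ≤-Reasoning

    ^-antitone : ∀ {x} {k l} → 0ℚ ≤ x → x ≤ 1ℚ → k ℕ.≤ l → x ^ l ≤ x ^ k
    ^-antitone {l = l} 0≤x x≤1 z≤n       = ^≤1 l 0≤x x≤1
    ^-antitone         0≤x x≤1 (s≤s k≤l) = *-monoˡ-≤ 0≤x (^-antitone 0≤x x≤1 k≤l)

    r^≤r : ∀ {k} n → 1 ℕ.≤ k → r n ^ k ≤ r n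
    r^≤r {k} n 1≤k = subst (r n ^ k ≤_) (*-identityʳ (r n)) (^-antitone (0≤r n) (r≤1 n) 1≤k)

    0≤partialSum : ∀ ks M → 0ℚ ≤ partialSum ks M
    0≤partialSum []       M       = nonNegative⁻¹ 1ℚ
    0≤partialSum (k ∷ ks) zero    = ≤-refl
    0≤partialSum (k ∷ ks) (suc M) =
      0≤+ (0≤partialSum (k ∷ ks) M) (0≤* (0≤^ k (0≤r M)) (0≤partialSum ks M))

    partialSum-step : ∀ k ks M → partialSum (k ∷ ks) M ≤ partialSum (k ∷ ks) (suc M)
    partialSum-step k ks M = subst (_≤ partialSum (k ∷ ks) (suc M)) (+-identityʳ (partialSum (k ∷ ks) M))
      (+-monoʳ-≤ (partialSum (k ∷ ks) M) (0≤* (0≤^ k (0≤r M)) (0≤partialSum ks M)))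

    partialSum-mono : ∀ k ks {p q} → p ℕ.≤ q → partialSum (k ∷ ks) p ≤ partialSum (k ∷ ks) q
    partialSum-mono k ks {p} p≤q = go (ℕ.≤⇒≤′ p≤q)
      where
      go : ∀ {q} → p ℕ.≤′ q → partialSum (k ∷ ks) p ≤ partialSum (k ∷ ks) q
      go ℕ.≤′-refl           = ≤-refl
      go (ℕ.≤′-step {q} p≤q) = ≤-trans (go p≤q) (partialSum-step k ks q)

    r*ει : ∀ ε n → r n * (ε * ι (suc n)) ≡ ε
    r*ει ε n = trans (*-left-comm (r n) ε (ι (suc n))) (trans (cong (ε *_) (r*ι n)) (*-identityʳ ε))

    -- Partial sums grow more slowly than any linear function.
    sublinear : ∀ {ks} → All (1 ℕ.≤_) ks → ∀ ε → 0ℚ < ε →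
                ∃ λ N → ∀ M → N ℕ.≤ M → partialSum ks M ≤ ε * ι M
    sublinear [] ε 0<ε =
      let c , _ , εc≡1 = reciprocal 0<ε
          N , c≤N      = archimedean c
      in N , λ M N≤M → subst (_≤ ε * ι M) εc≡1 (*-monoˡ-≤ (<⇒≤ 0<ε) (≤-trans c≤N (ι-mono N≤M)))
    sublinear {k ∷ ks} (1≤k ∷ ks≥1) ε 0<ε =
      let N , small    = sublinear ks≥1 e 0<e
          c , _ , ec≡1 = reciprocal 0<e
          N′ , cS≤N′   = archimedean (c * S N)
      in N ⊔ N′ , λ M N≤M → combine {S M} {S N} {e * ι N} {ι M}
           (antitone D N (λ n N≤n → step (small n N≤n)) ℕ.≤-refl (ℕ.m⊔n≤o⇒m≤o N N′ N≤M))
           (0≤* 0≤e (0≤ι N))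
           (subst (_≤ e * ι M) (cancel ec≡1)
             (*-monoˡ-≤ 0≤e (≤-trans cS≤N′ (ι-mono (ℕ.m⊔n≤o⇒n≤o N N′ N≤M)))))
      where
      open ≤-Reasoning
      e = half ε
      0<e = 0<half 0<ε
      0≤e = <⇒≤ 0<e
      S = partialSum (k ∷ ks)
      D : ℕ → ℚ
      D M = S M - e * ι M
      cancel : ∀ {c s} → e * c ≡ 1ℚ → e * (c * s) ≡ s
      cancel {c} {s} ec≡1 = trans (sym (*-assoc e c s)) (trans (cong (_* s) ec≡1) (*-identityˡ s))
      combine : ∀ {s s₀ a₀ m} → s - e * m ≤ s₀ - a₀ → 0ℚ ≤ a₀ → s₀ ≤ e * m → s ≤ ε * m
      combine {s} {s₀} {a₀} {m} h₁ 0≤a₀ h₂ = begin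
        s                        ≡⟨ p≡[p-q]+q s (e * m) ⟩
        (s - e * m) + e * m      ≤⟨ +-monoˡ-≤ (e * m) (≤-trans h₁ (≤-trans (p-q≤p 0≤a₀) h₂)) ⟩
        e * m + e * m            ≡⟨ sym (*-distribʳ-+ m e e) ⟩
        (e + e) * m              ≡⟨ cong (_* m) (half+half ε) ⟩
        ε * m                    ∎
      increment : ∀ {M} → partialSum ks M ≤ e * ι M → r M ^ k * partialSum ks M ≤ e
      increment {M} small = begin
        r M ^ k * partialSum ks M    ≤⟨ *-monoʳ-≤ (0≤partialSum ks M) (r^≤r M 1≤k) ⟩
        r M * partialSum ks M        ≤⟨ *-monoˡ-≤ (0≤r M) small ⟩
        r M * (e * ι M)              ≤⟨ *-monoˡ-≤ (0≤r M) (*-monoˡ-≤ 0≤e (ι-mono (ℕ.n≤1+n M))) ⟩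
        r M * (e * ι (suc M))        ≡⟨ r*ει e M ⟩
        e                            ∎
      add-increment : ∀ {s d m m′} → d ≤ e → m′ ≡ 1ℚ + m → (s + d) - e * m′ ≤ s - e * m
      add-increment {s} {d} {m} d≤e refl = 0≤diff⇒≤ (subst (0ℚ ≤_)
        (solve 4 (λ s d e m → e :- d := (s :- e :* m) :- ((s :+ d) :- e :* (con 1ℚ :+ m))) refl s d e m)
        (≤⇒0≤diff d≤e))
      step : ∀ {M} → partialSum ks M ≤ e * ι M → D (suc M) ≤ D M
      step {M} small = add-increment {S M} {r M ^ k * partialSum ks M} {ι M} {ι (suc M)} (increment small) (ι-suc M)

    -- Tails of the series with first exponent 2, by summation by parts:
    -- they are controlled by partialSum ks M / M and by the tails with the
    -- second entry removed.
    tail₂ : ∀ {ks} → All (1 ℕ.≤_) ks → ∀ ε → 0ℚ < ε → ∃ λ N → ∀ p q → N ℕ.≤ p → p ℕ.≤ q →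
            partialSum (2 ∷ ks) q ≤ partialSum (2 ∷ ks) p + ε
    tail₂ {[]} [] ε 0<ε =
      let N , small = sublinear [] ε 0<ε
      in suc N , λ { (suc p) (suc q) (s≤s N≤p) (s≤s p≤q) →
        ≤-trans (p≤p+q (0≤r q)) (≤-trans (antitone D 0 (λ n _ → step n) z≤n p≤q)
          (+-monoʳ-≤ (S (suc p)) (rp≤ε p (small (suc p) (ℕ.m≤n⇒m≤1+n N≤p))))) }
      where
      open ≤-Reasoning
      S = partialSum (2 ∷ [])
      D : ℕ → ℚ
      D n = S (suc n) + r n
      rp≤ε : ∀ p → 1ℚ ≤ ε * ι (suc p) → r p ≤ ε
      rp≤ε p small = begin
        r p                    ≡⟨ sym (*-identityʳ (r p)) ⟩
        r p * 1ℚ               ≤⟨ *-monoˡ-≤ (0≤r p) small ⟩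
        r p * (ε * ι (suc p))  ≡⟨ r*ει ε p ⟩
        ε                      ∎
      lemma : ∀ {s x y} → 0ℚ ≤ x → 0ℚ ≤ y → x + y * x ≡ y → (s + x * (x * 1ℚ) * 1ℚ) + x ≤ s + y
      lemma {s} {x} {y} 0≤x 0≤y eq = subst (λ z → (s + x * (x * 1ℚ) * 1ℚ) + x ≤ s + z) eq
        (0≤diff⇒≤ (subst (0ℚ ≤_)
          (solve 3 (λ s x y → x :* (y :- x) := (s :+ (x :+ y :* x)) :- ((s :+ x :* (x :* con 1ℚ) :* con 1ℚ) :+ x)) refl s x y)
          (0≤* 0≤x (≤⇒0≤diff (subst (x ≤_) eq (p≤p+q (0≤* 0≤y 0≤x)))))))
      step : ∀ n → D (suc n) ≤ D n
      step n = lemma {S (suc n)} {r (suc n)} {r n} (0≤r (suc n)) (0≤r n) (r-step n)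
    tail₂ {k ∷ ks} (1≤k ∷ ks≥1) ε 0<ε =
      let N₁ , small = sublinear (1≤k ∷ ks≥1) e (0<half 0<ε)
          N₂ , tail  = tail₂ ks≥1 e (0<half 0<ε)
      in suc (N₁ ⊔ N₂) , λ { (suc p) (suc q) (s≤s N≤p) (s≤s p≤q) → combine
        {S (suc q)} {r q * h (suc q)} {S′ (suc q)} {S (suc p)} {r p * h (suc p)} {S′ (suc p)}
        (0≤* (0≤r q) (0≤partialSum (k ∷ ks) (suc q)))
        (antitone D 0 (λ n _ → step n) z≤n p≤q)
        (tail (suc p) (suc q) (ℕ.m≤n⇒m≤1+n (ℕ.m⊔n≤o⇒n≤o N₁ N₂ N≤p)) (s≤s p≤q))
        (subst (r p * h (suc p) ≤_) (r*ει e p)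
          (*-monoˡ-≤ (0≤r p) (small (suc p) (ℕ.m≤n⇒m≤1+n (ℕ.m⊔n≤o⇒m≤o N₁ N₂ N≤p))))) }
      where
      open ≤-Reasoning
      e = half ε
      S = partialSum (2 ∷ k ∷ ks)
      S′ = partialSum (2 ∷ ks)
      h = partialSum (k ∷ ks)
      D : ℕ → ℚ
      D n = (S (suc n) + r n * h (suc n)) - S′ (suc n)
      combine : ∀ {s a s′ t b t′} → 0ℚ ≤ a → (s + a) - s′ ≤ (t + b) - t′ → s′ ≤ t′ + e → b ≤ e → s ≤ t + ε
      combine {s} {a} {s′} {t} {b} {t′} 0≤a h₁ h₂ b≤e = begin
        s                              ≤⟨ p≤p+q 0≤a ⟩
        s + a                          ≡⟨ p≡[p-q]+q (s + a) s′ ⟩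
        ((s + a) - s′) + s′            ≤⟨ +-mono-≤ h₁ h₂ ⟩
        ((t + b) - t′) + (t′ + e)      ≡⟨ solve 4 (λ t b t′ e → ((t :+ b) :- t′) :+ (t′ :+ e) := t :+ (b :+ e)) refl t b t′ e ⟩
        t + (b + e)                    ≤⟨ +-monoʳ-≤ t (+-monoˡ-≤ e b≤e) ⟩
        t + (e + e)                    ≡⟨ cong (λ z → t + z) (half+half ε) ⟩
        t + ε                          ∎
      lemma : ∀ {s s′ a b x y z} → 0ℚ ≤ a → 0ℚ ≤ b → 0ℚ ≤ x → 0ℚ ≤ y → x + y * x ≡ y → z ≤ x →
              ((s + x * (x * 1ℚ) * a) + x * (a + z * b)) - (s′ + x * (x * 1ℚ) * b) ≤ (s + y * a) - s′
      lemma {s} {s′} {a} {b} {x} {y} {z} 0≤a 0≤b 0≤x 0≤y eq z≤x =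
        subst (λ w → ((s + x * (x * 1ℚ) * a) + x * (a + z * b)) - (s′ + x * (x * 1ℚ) * b) ≤ (s + w * a) - s′) eq
          (0≤diff⇒≤ (subst (0ℚ ≤_)
            (solve 7 (λ s s′ a b x y z →
              x :* a :* (y :- x) :+ x :* b :* (x :- z) :=
              ((s :+ (x :+ y :* x) :* a) :- s′) :-
              (((s :+ x :* (x :* con 1ℚ) :* a) :+ x :* (a :+ z :* b)) :- (s′ :+ x :* (x :* con 1ℚ) :* b)))
              refl s s′ a b x y z)
            (0≤+ (0≤* (0≤* 0≤x 0≤a) (≤⇒0≤diff (subst (x ≤_) eq (p≤p+q (0≤* 0≤y 0≤x)))))
                 (0≤* (0≤* 0≤x 0≤b) (≤⇒0≤diff z≤x)))))
      step : ∀ n → D (suc n) ≤ D n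
      step n = lemma {S M} {S′ M} {h M} {partialSum ks M} {r M} {r n} {r M ^ k}
        (0≤partialSum (k ∷ ks) M) (0≤partialSum ks M) (0≤r M) (0≤r n) (r-step n) (r^≤r M 1≤k)
        where M = suc n

    tail : ∀ {k ks} → 2 ℕ.≤ k → All (1 ℕ.≤_) ks → ∀ ε → 0ℚ < ε → ∃ λ N → ∀ p q → N ℕ.≤ p → p ℕ.≤ q →
           partialSum (k ∷ ks) q ≤ partialSum (k ∷ ks) p + ε
    tail {k} {ks} 2≤k ks≥1 ε 0<ε =
      let N , tail′ = tail₂ ks≥1 ε 0<ε
      in N , λ p q N≤p p≤q → combine {S q} {S₂ q} {S p} {S₂ p}
           (antitone (λ n → S n - S₂ n) 0 (λ n _ → step n) z≤n p≤q) (tail′ p q N≤p p≤q)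
      where
      open ≤-Reasoning
      S = partialSum (k ∷ ks)
      S₂ = partialSum (2 ∷ ks)
      combine : ∀ {s s₂ t t₂} → s - s₂ ≤ t - t₂ → s₂ ≤ t₂ + ε → s ≤ t + ε
      combine {s} {s₂} {t} {t₂} h₁ h₂ = begin
        s                       ≡⟨ p≡[p-q]+q s s₂ ⟩
        (s - s₂) + s₂           ≤⟨ +-mono-≤ h₁ h₂ ⟩
        (t - t₂) + (t₂ + ε)     ≡⟨ solve 3 (λ a b e → (a :- b) :+ (b :+ e) := a :+ e) refl t t₂ ε ⟩
        t + ε                   ∎
      lemma : ∀ {s s₂ a b c} → a ≤ b → 0ℚ ≤ c → (s + a * c) - (s₂ + b * c) ≤ s - s₂
      lemma {s} {s₂} {a} {b} {c} a≤b 0≤c = 0≤diff⇒≤ (subst (0ℚ ≤_)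
        (solve 5 (λ s s₂ a b c → (b :- a) :* c := (s :- s₂) :- ((s :+ a :* c) :- (s₂ :+ b :* c))) refl s s₂ a b c)
        (0≤* (≤⇒0≤diff a≤b) 0≤c))
      step : ∀ n → S (suc n) - S₂ (suc n) ≤ S n - S₂ n
      step n = lemma {S n} {S₂ n} {r n ^ k} {r n ^ 2} (^-antitone (0≤r n) (r≤1 n) 2≤k) (0≤partialSum ks n)

    partialSum-cauchy : ∀ {k ks} → 2 ℕ.≤ k → All (1 ℕ.≤_) ks → ∀ ε → 0ℚ < ε →
      ∃ λ N → ∀ p q → N ℕ.≤ p → N ℕ.≤ q → ∣ partialSum (k ∷ ks) p - partialSum (k ∷ ks) q ∣ < ε
    partialSum-cauchy {k} {ks} 2≤k ks≥1 ε 0<ε =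
      let N , close = tail 2≤k ks≥1 (half ε) (0<half 0<ε)
      in N , total N close
      where
      S = partialSum (k ∷ ks)
      total : ∀ N → (∀ p q → N ℕ.≤ p → p ℕ.≤ q → S q ≤ S p + half ε) →
              ∀ p q → N ℕ.≤ p → N ℕ.≤ q → ∣ S p - S q ∣ < ε
      total N close p q N≤p N≤q = [ below , above ]′ (ℕ.≤-total p q)
        where
        below : p ℕ.≤ q → ∣ S p - S q ∣ < ε
        below p≤q = subst (_< ε) (∣-∣-swap (S q) (S p))
          (∣-∣-bound (S q) (S p) 0<ε (partialSum-mono k ks p≤q) (close p q N≤p p≤q))
        above : q ℕ.≤ p → ∣ S p - S q ∣ < ε
        above q≤p = ∣-∣-bound (S p) (S q) 0<ε (partialSum-mono k ks q≤p) (close q p N≤q q≤p)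

ζ : Index → ℝ
ζ (k , ks) .approx = partialSum (value k ∷ List.map value ks)
ζ (k , ks) .cauchy = Convergence.partialSum-cauchy (bound k) (bounds ks)

-- All indices k₁ □ k₂ □ ⋯ □ kₙ with each □ a comma or a plus sign; the first
-- □ is a comma in the left half of the list and a plus sign in the right half.
mergings : ∀ {b} → ℕ≥ b → List (ℕ≥ 1) → List (ℕ≥ b × List (ℕ≥ 1))
mergings k []       = (k , []) ∷ []
mergings k (l ∷ ls) = List.map (λ (p , ps) → k , p ∷ ps) (mergings l ls)
                   ++ mergings (k ⊕ value l) ls

dep : Index → ℕ
dep (k , ks) = suc (length ks)

ζᵗ : Index → Pol
ζᵗ (k , ks) = ∑[ p ← mergings k ks ] t ^ₚ (dep (k , ks) ℕ.∸ dep p) *ₚ constant (ζ p)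

tuples : ∀ {a} {A : Set a} → List A → ∀ N → List (Vec A N)
tuples xs zero    = Vec.[] ∷ []
tuples xs (suc N) = cartesianProductWith Vec._∷_ xs (tuples xs N)

1⋯_ : ℕ → List (ℕ≥ 1)
1⋯ M = List.map (λ i → suc i , [ s≤s z≤n ]) (upTo M)

-- Positive entries with sum M are at most M, so it suffices to search among
-- the tuples with entries in {1, …, M}.
𝒜 : ∀ N → ℕ → ℕ → List (Vec (ℕ≥ 1) N)
𝒜 N M j = filter (λ a → (Vec.sum (Vec.map value a) ℕ.≟ M) ×-dec
                        (Vec.count (λ aₛ → 2 ∣? value aₛ) a ℕ.≟ j))
                 (tuples (1⋯ M) N)

-- f a₁ (a₂, …, a_N), or 0 if there is no a₁.
splitFirst : ∀ {N} → Vec (ℕ≥ 1) N → (ℕ≥ 1 → List (ℕ≥ 1) → Pol) → Pol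
splitFirst Vec.[]       f = 0ₚ
splitFirst (a Vec.∷ as) f = f a (Vec.toList as)

{-# OPTIONS --safe #-}
module Submission where

-- Truncating all multiple zeta values at m₁ ≤ M and evaluating at a rational t = τ turns the
-- statement into an identity of rational numbers that holds exactly for every M and τ: truncated
-- interpolated values are multiplicative for the product
--   a v * b w = a (v * b w) + b (a v * w) + (1 - 2t) (a + b) (v * w) + (t² - t) (a + b) ∘ (v * w),
-- where c ∘ w adds c to the first letter of w (induction on M). Expanding m 1ⁿ * u 1ᵛ until both m
-- and u have been read leaves products 1ⁿ * 1ᵛ. These are the coefficients of xⁿyᵛ in 1 / (1 - Z),
-- where Z is the sum of (t² - t)ʰ (xy)ʰ (x + y) times the letter 2h + 1, over h ≥ 0, and of
-- (t² - t)ʰ⁻¹ (1 - 2t) (xy)ʰ times the letter 2h, over h ≥ 1. So a composition of n + v with j even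
-- entries and ∑ ⌊(aₛ - 1) / 2⌋ = i occurs with coefficient (t² - t)ⁱ (1 - 2t)ʲ times that of xⁿyᵛ
-- in (xy)ⁱ⁺ʲ (x + y)ⁿ⁺ᵛ⁻²⁽ⁱ⁺ʲ⁾. A polynomial vanishing at all positive rationals is zero.

open import Defs

-- No limit is taken because the operations of `ℝ` act on each approximant separately and the M-th
-- approximant of `ζ` is a truncated sum: an identity between the approximants at every M is already
-- an equality of reals. Linear combinations of words never occur as objects. A product of words is
-- known only through its values under arbitrary linear forms `F`, so that prefixing a letter is
-- precomposition and every induction runs on words with `F` free. What remains is bookkeeping: the
-- theorem groups tuples by length and number of even entries, while the product recurses on first
-- letters. The identity c = 1 + 2 ⌊(c - 1) / 2⌋ + [c even], summed over the entries c, translates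
-- between the two.

private module Proof where

  open import Algebra.Bundles using (module CommutativeRing)
  import Algebra.Definitions.RawSemiring as RawSemiringDefs
  import Algebra.Properties.Semiring.Mult as SemiringMult
  open import Data.Bool.Base as Bool using (true; false; if_then_else_; _∧_)
  open import Data.Bool.Properties using (∧-zeroʳ)
  import Data.Integer.Base as ℤ
  open import Data.Irrelevant using ([_])
  open import Data.List.Base using (List; []; _∷_; _++_; length; map; foldr; replicate; applyUpTo; upTo; filter; cartesianProductWith)
  open import Data.List.Properties using (map-++; map-replicate)
  open import Data.List.Relation.Unary.All as All using (All; []; _∷_)
  import Data.List.Relation.Unary.All.Properties as All
  open import Data.Nat.Base as ℕ using (ℕ; zero; suc; s≤s; z≤n; _≡ᵇ_)
  open import Data.Nat.Combinatorics as ℕ using (_C_)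
  open import Data.Nat.Divisibility using (_∣_; _∣?_; ∣⇒≤)
  import Data.Nat.Properties as ℕ
  import Data.Product.Base as Product
  open Product using (_,_; proj₁; proj₂; ∃)
  open import Data.Rational.Base hiding (truncate)
  open import Data.Rational.Properties
  open import Data.Rational.Solver using (module +-*-Solver)
  open import Data.Refinement using (value; _,_)
  open import Data.Sum.Base using (_⊎_; inj₁; inj₂)
  open import Data.Vec.Base as Vec using (Vec; []; _∷_; toList)
  open import Function.Base using (_∘_; id)
  open import Relation.Binary.PropositionalEquality hiding ([_])
  open import Relation.Nullary.Decidable using (Dec; does; yes; no; recompute; dec-false)
  open import Relation.Nullary.Negation using (contradiction; ¬_)
  open import Relation.Unary using (Decidable)

  open +-*-Solver using (solve; _:=_; _:+_; _:*_; _:-_; :-_; con)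
  open SemiringMult (CommutativeRing.semiring +-*-commutativeRing) using (_×_; ×-homo-+; ×-comm-*; ×-assoc-*)
  open RawSemiringDefs +-*-rawSemiring using (_^_)

  -- Finite sums

  ∑ℚ : ∀ {A : Set} → List A → (A → ℚ) → ℚ
  ∑ℚ xs f = foldr (λ x s → f x + s) 0ℚ xs

  ∑ℚ-congᴬ : ∀ {A : Set} {xs : List A} {f g} → All (λ x → f x ≡ g x) xs → ∑ℚ xs f ≡ ∑ℚ xs g
  ∑ℚ-congᴬ []         = refl
  ∑ℚ-congᴬ (eq ∷ eqs) = cong₂ _+_ eq (∑ℚ-congᴬ eqs)

  ∑ℚ-cong : ∀ {A : Set} (xs : List A) {f g} → (∀ x → f x ≡ g x) → ∑ℚ xs f ≡ ∑ℚ xs g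
  ∑ℚ-cong []       eq = refl
  ∑ℚ-cong (x ∷ xs) eq = cong₂ _+_ (eq x) (∑ℚ-cong xs eq)

  ∑ℚ-++ : ∀ {A : Set} (xs ys : List A) f → ∑ℚ (xs ++ ys) f ≡ ∑ℚ xs f + ∑ℚ ys f
  ∑ℚ-++ []       ys f = sym (+-identityˡ _)
  ∑ℚ-++ (x ∷ xs) ys f = trans (cong (f x +_) (∑ℚ-++ xs ys f)) (sym (+-assoc (f x) _ _))

  ∑ℚ-map : ∀ {A B : Set} (h : A → B) xs f → ∑ℚ (map h xs) f ≡ ∑ℚ xs (f ∘ h)
  ∑ℚ-map h []       f = refl
  ∑ℚ-map h (x ∷ xs) f = cong (f (h x) +_) (∑ℚ-map h xs f)

  ∑ℚ-* : ∀ {A : Set} c (xs : List A) f → ∑ℚ xs (λ x → c * f x) ≡ c * ∑ℚ xs f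
  ∑ℚ-* c []       f = sym (*-zeroʳ c)
  ∑ℚ-* c (x ∷ xs) f = trans (cong (c * f x +_) (∑ℚ-* c xs f)) (sym (*-distribˡ-+ c (f x) _))

  ∑ℚ-zero : ∀ {A : Set} (xs : List A) → ∑ℚ xs (λ _ → 0ℚ) ≡ 0ℚ
  ∑ℚ-zero []       = refl
  ∑ℚ-zero (x ∷ xs) = trans (+-identityˡ _) (∑ℚ-zero xs)

  ∑< : ℕ → (ℕ → ℚ) → ℚ
  ∑< zero    f = 0ℚ
  ∑< (suc n) f = f 0 + ∑< n (f ∘ suc)

  ∑<-cong : ∀ n {f g} → (∀ i → i ℕ.< n → f i ≡ g i) → ∑< n f ≡ ∑< n g
  ∑<-cong zero    eq = refl
  ∑<-cong (suc n) eq = cong₂ _+_ (eq 0 (s≤s z≤n)) (∑<-cong n (λ i i<n → eq (suc i) (s≤s i<n)))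

  ∑<-zero : ∀ n → ∑< n (λ _ → 0ℚ) ≡ 0ℚ
  ∑<-zero zero    = refl
  ∑<-zero (suc n) = trans (+-identityˡ _) (∑<-zero n)

  ∑ℚ-applyUpTo : ∀ {A : Set} (h : ℕ → A) n f → ∑ℚ (applyUpTo h n) f ≡ ∑< n (f ∘ h)
  ∑ℚ-applyUpTo h zero    f = refl
  ∑ℚ-applyUpTo h (suc n) f = cong (f (h 0) +_) (∑ℚ-applyUpTo (h ∘ suc) n f)

  ∑ℚ-upTo : ∀ n f → ∑ℚ (upTo n) f ≡ ∑< n f
  ∑ℚ-upTo = ∑ℚ-applyUpTo (λ i → i)

  -- Words and compositions

  -- The linear form w ↦ F (a ∘ w), where a is added to the first letter of w and a ∘ 1 = 0.
  infixr 5 _▷_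
  _▷_ : ℕ → (List ℕ → ℚ) → List ℕ → ℚ
  (a ▷ F) []      = 0ℚ
  (a ▷ F) (b ∷ w) = F (a ℕ.+ b ∷ w)

  ▷-cong : ∀ a {F G} → (∀ w → F w ≡ G w) → ∀ w → (a ▷ F) w ≡ (a ▷ G) w
  ▷-cong a eq []      = refl
  ▷-cong a eq (b ∷ w) = eq _

  ▷-+ : ∀ a F G x → (a ▷ λ y → F y + G y) x ≡ (a ▷ F) x + (a ▷ G) x
  ▷-+ a F G []      = sym (+-identityˡ 0ℚ)
  ▷-+ a F G (b ∷ x) = refl

  ▷-* : ∀ a c F x → (a ▷ λ y → c * F y) x ≡ c * (a ▷ F) x
  ▷-* a c F []      = sym (*-zeroʳ c)
  ▷-* a c F (b ∷ x) = refl

  -- The sum of p i j * F w over the compositions w of N, where j is the number of even entries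
  -- of w and i is the sum of ⌊(c - 1) / 2⌋ over its entries c.
  compositions : ℕ → (ℕ → ℕ → ℚ) → (List ℕ → ℚ) → ℚ
  compositions 0             p F = p 0 0 * F []
  compositions 1             p F = p 0 0 * F (1 ∷ [])
  compositions (suc (suc N)) p F =
    compositions (suc N) p (F ∘ (1 ∷_)) +
    (compositions N (λ i j → p i (suc j)) (F ∘ (2 ∷_)) + compositions N (λ i j → p (suc i) j) (2 ▷ F))

  -- The bound comes from 2 ⌊(c - 1) / 2⌋ + 2 [c even] ≤ c for each entry c. It is recorded because
  -- `coefficient-pascal` fails beyond it.
  compositions-cong : ∀ N {p q} F → (∀ i j → 2 ℕ.* (i ℕ.+ j) ℕ.≤ N → p i j ≡ q i j) →
                      compositions N p F ≡ compositions N q F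
  compositions-cong 0             F eq = cong (_* F []) (eq 0 0 z≤n)
  compositions-cong 1             F eq = cong (_* F (1 ∷ [])) (eq 0 0 z≤n)
  compositions-cong (suc (suc N)) F eq = cong₂ _+_
    (compositions-cong (suc N) (F ∘ (1 ∷_)) (λ i j le → eq i j (ℕ.m≤n⇒m≤1+n le)))
    (cong₂ _+_ (compositions-cong N (F ∘ (2 ∷_)) (λ i j le → eq i (suc j) (bound i j le)))
               (compositions-cong N (2 ▷ F) (λ i j le → eq (suc i) j (bound′ i j le))))
    where
    bound′ : ∀ i j → 2 ℕ.* (i ℕ.+ j) ℕ.≤ N → 2 ℕ.* (suc i ℕ.+ j) ℕ.≤ suc (suc N)
    bound′ i j le = subst (ℕ._≤ suc (suc N)) (sym (ℕ.*-suc 2 (i ℕ.+ j))) (s≤s (s≤s le))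
    bound : ∀ i j → 2 ℕ.* (i ℕ.+ j) ℕ.≤ N → 2 ℕ.* (i ℕ.+ suc j) ℕ.≤ suc (suc N)
    bound i j le = subst (λ k → 2 ℕ.* k ℕ.≤ suc (suc N)) (sym (ℕ.+-suc i j)) (bound′ i j le)

  compositions-+ : ∀ N p q F →
    compositions N (λ i j → p i j + q i j) F ≡ compositions N p F + compositions N q F
  compositions-+ 0             p q F = *-distribʳ-+ (F []) (p 0 0) (q 0 0)
  compositions-+ 1             p q F = *-distribʳ-+ (F (1 ∷ [])) (p 0 0) (q 0 0)
  compositions-+ (suc (suc N)) p q F = trans
    (cong₂ _+_ (compositions-+ (suc N) p q (F ∘ (1 ∷_)))
      (cong₂ _+_ (compositions-+ N p₂ q₂ (F ∘ (2 ∷_))) (compositions-+ N p₃ q₃ (2 ▷ F))))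
    (rearrange (compositions (suc N) p (F ∘ (1 ∷_))) (compositions (suc N) q (F ∘ (1 ∷_)))
      (compositions N p₂ (F ∘ (2 ∷_))) (compositions N q₂ (F ∘ (2 ∷_)))
      (compositions N p₃ (2 ▷ F)) (compositions N q₃ (2 ▷ F)))
    where
    p₂ = λ i j → p i (suc j)
    q₂ = λ i j → q i (suc j)
    p₃ = λ i j → p (suc i) j
    q₃ = λ i j → q (suc i) j
    rearrange = solve 6 (λ a a′ b b′ c c′ →
      (a :+ a′) :+ ((b :+ b′) :+ (c :+ c′)) := (a :+ (b :+ c)) :+ (a′ :+ (b′ :+ c′))) refl

  compositions-* : ∀ c N p F → compositions N (λ i j → c * p i j) F ≡ c * compositions N p F
  compositions-* c 0             p F = *-assoc c (p 0 0) (F [])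
  compositions-* c 1             p F = *-assoc c (p 0 0) (F (1 ∷ []))
  compositions-* c (suc (suc N)) p F = trans
    (cong₂ _+_ (compositions-* c (suc N) p (F ∘ (1 ∷_)))
      (cong₂ _+_ (compositions-* c N p₂ (F ∘ (2 ∷_))) (compositions-* c N p₃ (2 ▷ F))))
    (rearrange c (compositions (suc N) p (F ∘ (1 ∷_)))
      (compositions N p₂ (F ∘ (2 ∷_))) (compositions N p₃ (2 ▷ F)))
    where
    p₂ = λ i j → p i (suc j)
    p₃ = λ i j → p (suc i) j
    rearrange = solve 4 (λ c x y z → c :* x :+ (c :* y :+ c :* z) := c :* (x :+ (y :+ z))) refl

  compositions-zero : ∀ N p F → (∀ i j → p i j ≡ 0ℚ) → compositions N p F ≡ 0ℚ
  compositions-zero N p F eq = begin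
    compositions N p F                     ≡⟨ compositions-cong N F (λ i j _ → trans (eq i j) (sym (*-zeroˡ (p i j)))) ⟩
    compositions N (λ i j → 0ℚ * p i j) F  ≡⟨ compositions-* 0ℚ N p F ⟩
    0ℚ * compositions N p F                ≡⟨ *-zeroˡ (compositions N p F) ⟩
    0ℚ                                     ∎
    where open ≡-Reasoning

  -- Both statistics vanish only on the word 1 ⋯ 1, since any entry above 1 is even or at least 3.
  compositions-ones : ∀ N p F → p 0 0 ≡ 1ℚ → (∀ i j → p i (suc j) ≡ 0ℚ) → (∀ i j → p (suc i) j ≡ 0ℚ) →
                      compositions N p F ≡ F (replicate N 1)
  compositions-ones 0             p F p₀ p₁ p₂ = trans (cong (_* F []) p₀) (*-identityˡ (F []))
  compositions-ones 1             p F p₀ p₁ p₂ = trans (cong (_* F (1 ∷ [])) p₀) (*-identityˡ (F (1 ∷ [])))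
  compositions-ones (suc (suc N)) p F p₀ p₁ p₂ = begin
    compositions (suc N) p (F ∘ (1 ∷_)) + (compositions N (λ i j → p i (suc j)) (F ∘ (2 ∷_)) + compositions N (λ i j → p (suc i) j) (2 ▷ F))
      ≡⟨ cong₂ _+_ (compositions-ones (suc N) p (F ∘ (1 ∷_)) p₀ p₁ p₂)
           (cong₂ _+_ (compositions-zero N _ (F ∘ (2 ∷_)) p₁) (compositions-zero N _ (2 ▷ F) p₂)) ⟩
    F (replicate (suc (suc N)) 1) + 0ℚ
      ≡⟨ +-identityʳ _ ⟩
    F (replicate (suc (suc N)) 1) ∎
    where open ≡-Reasoning

  -- The coefficient of xⁿyᵛ in (xy)ᵏ(x + y)ⁿ⁺ᵛ⁻²ᵏ.
  coefficient : ℕ → ℕ → ℕ → ℕ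
  coefficient n       v       zero    = (n ℕ.+ v) C n
  coefficient (suc n) (suc v) (suc k) = coefficient n v k
  coefficient zero    v       (suc k) = 0
  coefficient (suc n) zero    (suc k) = 0

  -- One factor x + y is split off, so its exponent n + v + 2 - 2k must be positive. Without the
  -- bound the rule fails: for n = v = 0 and k = 1 the left side is 1 and the right side 0.
  coefficient-pascal : ∀ n v k → 2 ℕ.* k ℕ.≤ suc (n ℕ.+ v) →
    coefficient (suc n) (suc v) k ≡ coefficient n (suc v) k ℕ.+ coefficient (suc n) v k
  coefficient-pascal n v zero le = begin
    suc (n ℕ.+ suc v) C suc n                         ≡⟨ ℕ.nCk+nC[k+1]≡[n+1]C[k+1] (n ℕ.+ suc v) n ⟨
    (n ℕ.+ suc v) C n ℕ.+ (n ℕ.+ suc v) C suc n       ≡⟨ cong (λ s → (n ℕ.+ suc v) C n ℕ.+ s C suc n) (ℕ.+-suc n v) ⟩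
    (n ℕ.+ suc v) C n ℕ.+ (suc n ℕ.+ v) C suc n       ∎
    where open ≡-Reasoning
  coefficient-pascal zero zero (suc k) le rewrite ℕ.*-suc 2 k with le
  ... | s≤s ()
  coefficient-pascal zero (suc v) (suc zero)    le = refl
  coefficient-pascal zero (suc v) (suc (suc k)) le = refl
  coefficient-pascal (suc n) zero (suc zero)    le = begin
    (suc n ℕ.+ 0) C suc n                ≡⟨ cong (_C suc n) (ℕ.+-identityʳ (suc n)) ⟩
    suc n C suc n                        ≡⟨ ℕ.nCn≡1 (suc n) ⟩
    1                                    ≡⟨ ℕ.nCn≡1 n ⟨
    n C n                                ≡⟨ cong (_C n) (ℕ.+-identityʳ n) ⟨
    (n ℕ.+ 0) C n                        ≡⟨ ℕ.+-identityʳ _ ⟨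
    (n ℕ.+ 0) C n ℕ.+ 0                  ∎
    where open ≡-Reasoning
  coefficient-pascal (suc n) zero (suc (suc k)) le = sym (trans (ℕ.+-identityʳ _) (vanish n))
    where
    vanish : ∀ n → coefficient n 0 (suc k) ≡ 0
    vanish zero    = refl
    vanish (suc n) = refl
  coefficient-pascal (suc n) (suc v) (suc k) le =
    coefficient-pascal n v k (ℕ.s≤s⁻¹ (ℕ.s≤s⁻¹ (subst₂ ℕ._≤_ (ℕ.*-suc 2 k) (cong (suc ∘ suc) (ℕ.+-suc n v)) le)))

  coefficient-C : ∀ n v k → k ℕ.≤ n ℕ.⊓ v → coefficient n v k ≡ (v ℕ.+ n ℕ.∸ 2 ℕ.* k) C (n ℕ.∸ k)
  coefficient-C n v zero le = cong (_C n) (ℕ.+-comm n v)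
  coefficient-C (suc n) (suc v) (suc k) (s≤s le) =
    trans (coefficient-C n v k le) (cong (_C (n ℕ.∸ k))
      (sym (cong₂ ℕ._∸_ (ℕ.+-suc v n) (ℕ.+-suc k (k ℕ.+ 0)))))

  coefficient-zero : ∀ n v k → n ℕ.⊓ v ℕ.< k → coefficient n v k ≡ 0
  coefficient-zero zero    v       (suc k) lt       = refl
  coefficient-zero (suc n) zero    (suc k) lt       = refl
  coefficient-zero (suc n) (suc v) (suc k) (s≤s lt) = coefficient-zero n v k lt

  -- Sums over 𝒜

  ∑ℚ-filter : ∀ {A : Set} {P : A → Set} (P? : Decidable P) xs f →
              ∑ℚ (filter P? xs) f ≡ ∑ℚ xs (λ x → if does (P? x) then f x else 0ℚ)
  ∑ℚ-filter P? []       f = refl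
  ∑ℚ-filter P? (x ∷ xs) f with does (P? x)
  ... | true  = cong (f x +_) (∑ℚ-filter P? xs f)
  ... | false = trans (∑ℚ-filter P? xs f) (sym (+-identityˡ _))

  ∑ℚ-cartesianProductWith : ∀ {A B D : Set} (_∙_ : A → B → D) xs ys f →
    ∑ℚ (cartesianProductWith _∙_ xs ys) f ≡ ∑ℚ xs (λ x → ∑ℚ ys (λ y → f (x ∙ y)))
  ∑ℚ-cartesianProductWith _∙_ []       ys f = refl
  ∑ℚ-cartesianProductWith _∙_ (x ∷ xs) ys f = trans (∑ℚ-++ (map (x ∙_) ys) _ f)
    (cong₂ _+_ (∑ℚ-map (x ∙_) ys f) (∑ℚ-cartesianProductWith _∙_ xs ys f))

  values : ∀ {N} → Vec (ℕ≥ 1) N → List ℕ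
  values a = map value (Vec.toList a)

  total evens : ∀ {N} → Vec (ℕ≥ 1) N → ℕ
  total a = Vec.sum (Vec.map value a)
  evens a = Vec.count (λ c → 2 ∣? value c) a

  -- This is the form to which the filter of `𝒜` computes, `×-dec` and `ℕ.≟` becoming `∧` and `≡ᵇ`.
  -- Removing a first letter then acts on the conditions by computation.
  restricted : ∀ {N} → ℕ → ℕ → (List ℕ → ℚ) → Vec (ℕ≥ 1) N → ℚ
  restricted M j F a = if (total a ≡ᵇ M) ∧ (evens a ≡ᵇ j) then F (values a) else 0ℚ

  restricted-zero : ∀ {N} M j {F} (a : Vec (ℕ≥ 1) N) → F (values a) ≡ 0ℚ → restricted M j F a ≡ 0ℚ
  restricted-zero M j a eq with (total a ≡ᵇ M) ∧ (evens a ≡ᵇ j)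
  ... | true  = eq
  ... | false = refl

  -- Every entry is at least 1 and every even entry at least 2. This shows that tuples whose
  -- prescribed total is too small contribute nothing.
  length+evens≤total : ∀ {N} (a : Vec (ℕ≥ 1) N) → N ℕ.+ evens a ℕ.≤ total a
  length+evens≤total [] = z≤n
  length+evens≤total {suc N} ((k , [ 1≤k ]) ∷ a) = cons (2 ∣? k) (length+evens≤total a)
    where
    instance
      k≢0 : ℕ.NonZero k
      k≢0 = ℕ.>-nonZero (recompute (1 ℕ.≤? k) 1≤k)
    cons : ∀ {e s} (even? : Dec (2 ∣ k)) → N ℕ.+ e ℕ.≤ s →
           suc N ℕ.+ (if does even? then suc else id) e ℕ.≤ k ℕ.+ s
    cons         (no  _)   le = ℕ.+-mono-≤ (ℕ.>-nonZero⁻¹ k) le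
    cons {e} {s} (yes 2∣k) le =
      subst (ℕ._≤ k ℕ.+ s) (cong suc (sym (ℕ.+-suc N e))) (ℕ.+-mono-≤ (∣⇒≤ 2∣k) le)

  restricted-vanishes : ∀ {N} M j F (a : Vec (ℕ≥ 1) N) → M ℕ.< N ℕ.+ j → restricted M j F a ≡ 0ℚ
  restricted-vanishes {N} M j F a lt with total a ≡ᵇ M in eq₁ | evens a ≡ᵇ j in eq₂
  ... | false | _     = refl
  ... | true  | false = refl
  ... | true  | true  = contradiction
    (subst₂ (λ e s → N ℕ.+ e ℕ.≤ s) (ℕ.≡ᵇ⇒≡ (evens a) j (subst Bool.T (sym eq₂) _)) (ℕ.≡ᵇ⇒≡ (total a) M (subst Bool.T (sym eq₁) _))
            (length+evens≤total a))
    (ℕ.<⇒≱ lt)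

  letter : ℕ → ℕ≥ 1
  letter i = suc i , [ s≤s z≤n ]

  ∑tuples : ∀ N → ℕ → ℕ → ℕ → (List ℕ → ℚ) → ℚ
  ∑tuples N B M j F = ∑ℚ (tuples (1⋯ B) N) (restricted M j F)

  -- The first letter is at most b and the others are at most B, so that b can decrease by itself.
  ∑tuples∷ : ∀ N → ℕ → ℕ → ℕ → ℕ → (List ℕ → ℚ) → ℚ
  ∑tuples∷ N b B M j F = ∑< b (λ i → ∑ℚ (tuples (1⋯ B) N) (λ a → restricted M j F (letter i ∷ a)))

  ∑𝒜 : ∀ N M j F → ∑ℚ (𝒜 N M j) (F ∘ values) ≡ ∑tuples N M M j F
  ∑𝒜 N M j F = ∑ℚ-filter _ (tuples (1⋯ M) N) (F ∘ values)

  ∑tuples-suc : ∀ N B M j F → ∑tuples (suc N) B M j F ≡ ∑tuples∷ N B B M j F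
  ∑tuples-suc N B M j F = trans (∑ℚ-cartesianProductWith _∷_ (1⋯ B) (tuples (1⋯ B) N) (restricted M j F))
    (trans (∑ℚ-map letter (upTo B) first) (∑ℚ-upTo B (first ∘ letter)))
    where
    first : ℕ≥ 1 → ℚ
    first x = ∑ℚ (tuples (1⋯ B) N) (λ a → restricted M j F (x ∷ a))

  ∑tuples-zero : ∀ N B M j {F} → (∀ (a : Vec (ℕ≥ 1) N) → restricted M j F a ≡ 0ℚ) → ∑tuples N B M j F ≡ 0ℚ
  ∑tuples-zero N B M j eq = trans (∑ℚ-cong (tuples (1⋯ B) N) eq) (∑ℚ-zero (tuples (1⋯ B) N))

  ∑tuples∷-zero : ∀ N b B M j {F} → (∀ i (a : Vec (ℕ≥ 1) N) → restricted M j F (letter i ∷ a) ≡ 0ℚ) →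
                  ∑tuples∷ N b B M j F ≡ 0ℚ
  ∑tuples∷-zero N b B M j eq = trans
    (∑<-cong b (λ i _ → trans (∑ℚ-cong (tuples (1⋯ B) N) (eq i)) (∑ℚ-zero (tuples (1⋯ B) N)))) (∑<-zero b)

  -- A first letter 2 + c is replaced by c, which has the same parity.
  ∑tuples∷-step : ∀ N b B M j F →
    ∑tuples∷ N (suc (suc b)) B (suc (suc M)) (suc j) F ≡
    ∑tuples N B (suc M) (suc j) (F ∘ (1 ∷_)) + (∑tuples N B M j (F ∘ (2 ∷_)) + ∑tuples∷ N b B M (suc j) (2 ▷ F))
  ∑tuples∷-step N b B M j F = refl

  -- When no even entry is allowed, a first letter 2 is excluded. The rest is computation: the
  -- remainder modulo 2 returns to its initial state after two steps, and `2 ▷ F` restores the 2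
  -- that was taken away.
  ∑tuples∷-step₀ : ∀ N b B M F →
    ∑tuples∷ N (suc (suc b)) B (suc (suc M)) 0 F ≡
    ∑tuples N B (suc M) 0 (F ∘ (1 ∷_)) + (0ℚ + ∑tuples∷ N b B M 0 (2 ▷ F))
  ∑tuples∷-step₀ N b B M F = cong (∑tuples N B (suc M) 0 (F ∘ (1 ∷_)) +_) (cong₂ _+_
    (trans (∑ℚ-cong (tuples (1⋯ B) N) (λ a → cong (λ c → if c then F (2 ∷ values a) else 0ℚ) (∧-zeroʳ (total a ≡ᵇ M))))
           (∑ℚ-zero (tuples (1⋯ B) N)))
    refl)

  δℚ : ℕ → ℕ → ℚ
  δℚ zero    zero    = 1ℚ
  δℚ zero    (suc n) = 0ℚ
  δℚ (suc m) zero    = 0ℚ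
  δℚ (suc m) (suc n) = δℚ m n

  unit : ℕ → ℕ → ℕ → ℕ → ℚ
  unit i j i′ j′ = δℚ i i′ * δℚ j j′

  compositions-unit-i0 : ∀ N i F → compositions N (λ i′ j′ → unit i 0 i′ (suc j′)) F ≡ 0ℚ
  compositions-unit-i0 N i F = compositions-zero N _ F (λ i′ j′ → *-zeroʳ (δℚ i i′))

  compositions-unit-0j : ∀ N j F → compositions N (λ i′ j′ → unit 0 j (suc i′) j′) F ≡ 0ℚ
  compositions-unit-0j N j F = compositions-zero N _ F (λ i′ j′ → *-zeroˡ (δℚ j j′))

  -- In a composition of M, 2 i + j is M minus the number of entries, hence at most M.
  compositions-unit-vanishes : ∀ M i j F → M ℕ.< i ℕ.* 2 ℕ.+ j → compositions M (unit i j) F ≡ 0ℚ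
  compositions-unit-vanishes 0 zero    (suc j) F lt = *-zeroˡ (F [])
  compositions-unit-vanishes 0 (suc i) j       F lt = trans (cong (_* F []) (*-zeroˡ (δℚ j 0))) (*-zeroˡ (F []))
  compositions-unit-vanishes 1 zero    (suc j) F lt = *-zeroˡ (F (1 ∷ []))
  compositions-unit-vanishes 1 (suc i) j       F lt = trans (cong (_* F (1 ∷ [])) (*-zeroˡ (δℚ j 0))) (*-zeroˡ (F (1 ∷ [])))
  compositions-unit-vanishes (suc (suc M)) i j F lt = cong₂ _+_
    (compositions-unit-vanishes (suc M) i j (F ∘ (1 ∷_)) (ℕ.≤-trans (ℕ.n≤1+n _) lt))
    (cong₂ _+_ (second j lt) (third i lt))
    where
    second : ∀ j → suc (suc M) ℕ.< i ℕ.* 2 ℕ.+ j → compositions M (λ i′ j′ → unit i j i′ (suc j′)) (F ∘ (2 ∷_)) ≡ 0ℚ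
    second zero    lt = compositions-unit-i0 M i (F ∘ (2 ∷_))
    second (suc j) lt = compositions-unit-vanishes M i j (F ∘ (2 ∷_))
      (ℕ.≤-trans (ℕ.n≤1+n (suc M)) (ℕ.s≤s⁻¹ (subst (suc (suc M) ℕ.<_) (ℕ.+-suc (i ℕ.* 2) j) lt)))
    third : ∀ i → suc (suc M) ℕ.< i ℕ.* 2 ℕ.+ j → compositions M (λ i′ j′ → unit i j (suc i′) j′) (2 ▷ F) ≡ 0ℚ
    third zero    lt = compositions-unit-0j M j (2 ▷ F)
    third (suc i) lt = compositions-unit-vanishes M i j (2 ▷ F) (ℕ.s≤s⁻¹ (ℕ.s≤s⁻¹ lt))

  mutual
    -- Adding up c = 1 + 2 ⌊(c - 1) / 2⌋ + [c even] gives M = N + 2 i + j: once j is fixed,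
    -- prescribing the length N amounts to prescribing i. `B` may exceed M because the recursion
    -- lowers the total but not the range of the later entries.
    ∑tuples-compositions : ∀ M N i j {B} F → M ℕ.≤ B → N ℕ.+ (i ℕ.* 2 ℕ.+ j) ≡ M →
                           ∑tuples N B M j F ≡ compositions M (unit i j) F
    ∑tuples-compositions M (suc N) i j {B} F M≤B eq =
      trans (∑tuples-suc N B M j F) (∑tuples∷-compositions M N i j F M≤B M≤B eq)
    ∑tuples-compositions 0 zero zero    zero F M≤B eq =
      trans (+-identityʳ (F [])) (sym (*-identityˡ (F [])))
    ∑tuples-compositions 1 zero zero (suc zero) F M≤B eq = sym (*-zeroˡ (F (1 ∷ [])))
    ∑tuples-compositions (suc (suc M)) zero i j F M≤B eq = sym (cong₂ _+_
      (compositions-unit-vanishes (suc M) i j (F ∘ (1 ∷_)) (ℕ.≤-reflexive (sym eq)))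
      (cong₂ _+_ (second j eq) (third i eq)))
      where
      second : ∀ j → i ℕ.* 2 ℕ.+ j ≡ suc (suc M) → compositions M (λ i′ j′ → unit i j i′ (suc j′)) (F ∘ (2 ∷_)) ≡ 0ℚ
      second zero    eq = compositions-unit-i0 M i (F ∘ (2 ∷_))
      second (suc j) eq = compositions-unit-vanishes M i j (F ∘ (2 ∷_))
        (ℕ.≤-reflexive (sym (ℕ.suc-injective (trans (sym (ℕ.+-suc (i ℕ.* 2) j)) eq))))
      third : ∀ i → i ℕ.* 2 ℕ.+ j ≡ suc (suc M) → compositions M (λ i′ j′ → unit i j (suc i′) j′) (2 ▷ F) ≡ 0ℚ
      third zero    eq = compositions-unit-0j M j (2 ▷ F)
      -- If M = 0, the empty composition has the required statistics; it contributes nothing because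
      -- `2 ▷ F` is 0 on the empty word.
      third (suc i) eq = trans
        (sym (∑tuples-compositions M 0 i j (2 ▷ F) ℕ.≤-refl (ℕ.suc-injective (ℕ.suc-injective eq))))
        (∑tuples-zero 0 M M j {2 ▷ F} (λ { [] → restricted-zero M j {2 ▷ F} [] refl }))

    ∑tuples∷-compositions : ∀ M N i j {b B} F → M ℕ.≤ b → M ℕ.≤ B → suc N ℕ.+ (i ℕ.* 2 ℕ.+ j) ≡ M →
                            ∑tuples∷ N b B M j F ≡ compositions M (unit i j) F
    ∑tuples∷-compositions 1 zero zero zero {suc b} {B} F (s≤s le) M≤B eq = trans
      (cong₂ _+_ (+-identityʳ (F (1 ∷ []))) (trans (∑<-cong b (λ _ _ → +-identityˡ 0ℚ)) (∑<-zero b)))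
      (trans (+-identityʳ (F (1 ∷ []))) (sym (*-identityˡ (F (1 ∷ [])))))
    ∑tuples∷-compositions (suc (suc M)) N i zero {suc (suc b)} {B} F (s≤s (s≤s M≤b)) M≤B eq = trans
      (∑tuples∷-step₀ N b B M F)
      (cong₂ _+_
        (∑tuples-compositions (suc M) N i 0 (F ∘ (1 ∷_)) (ℕ.≤-trans (ℕ.n≤1+n _) M≤B) (ℕ.suc-injective eq))
        (cong₂ _+_ (sym (compositions-unit-i0 M i (F ∘ (2 ∷_)))) (∑tuples∷-third M N i 0 F M≤b M≤B eq)))
    ∑tuples∷-compositions (suc (suc M)) N i (suc j) {suc (suc b)} {B} F (s≤s (s≤s M≤b)) M≤B eq = trans
      (∑tuples∷-step N b B M j F)
      (cong₂ _+_
        (∑tuples-compositions (suc M) N i (suc j) (F ∘ (1 ∷_)) (ℕ.≤-trans (ℕ.n≤1+n _) M≤B) (ℕ.suc-injective eq))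
        (cong₂ _+_
          (∑tuples-compositions M N i j (F ∘ (2 ∷_)) (ℕ.≤-trans (ℕ.m≤n+m M 2) M≤B)
            (ℕ.suc-injective (trans (trans (sym (ℕ.+-suc N (i ℕ.* 2 ℕ.+ j))) (cong (N ℕ.+_) (sym (ℕ.+-suc (i ℕ.* 2) j)))) (ℕ.suc-injective eq))))
          (∑tuples∷-third M N i (suc j) F M≤b M≤B eq)))

    -- For i = 0 no entry may exceed 2. On the side of tuples this shows as a remaining total M
    -- below the least possible value, suc N + j.
    ∑tuples∷-third : ∀ M N i j {b B} F → M ℕ.≤ b → 2 ℕ.+ M ℕ.≤ B → suc N ℕ.+ (i ℕ.* 2 ℕ.+ j) ≡ 2 ℕ.+ M →
                     ∑tuples∷ N b B M j (2 ▷ F) ≡ compositions M (λ i′ j′ → unit i j (suc i′) j′) (2 ▷ F)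
    ∑tuples∷-third M N zero j {b} {B} F M≤b M≤B eq = trans
      (∑tuples∷-zero N b B M j {2 ▷ F} (λ i a → restricted-vanishes M j (2 ▷ F) (letter i ∷ a) (ℕ.≤-trans (ℕ.n≤1+n _) (ℕ.≤-reflexive (sym eq)))))
      (sym (compositions-unit-0j M j (2 ▷ F)))
    ∑tuples∷-third M N (suc i) j F M≤b M≤B eq =
      ∑tuples∷-compositions M N i j (2 ▷ F) M≤b (ℕ.≤-trans (ℕ.m≤n+m M 2) M≤B)
        (ℕ.suc-injective (ℕ.suc-injective (trans (cong suc (sym (trans (ℕ.+-suc N _) (cong suc (ℕ.+-suc N (i ℕ.* 2 ℕ.+ j)))))) eq)))

  ∑<-δℚ : ∀ n (f : ℕ → ℚ) {m} → m ℕ.< n → ∑< n (λ i → f i * δℚ i m) ≡ f m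
  ∑<-δℚ (suc n) f {zero} lt = begin
    f 0 * 1ℚ + ∑< n (λ i → f (suc i) * 0ℚ)  ≡⟨ cong₂ _+_ (*-identityʳ (f 0)) (trans (∑<-cong n (λ i _ → *-zeroʳ (f (suc i)))) (∑<-zero n)) ⟩
    f 0 + 0ℚ                                ≡⟨ +-identityʳ (f 0) ⟩
    f 0                                     ∎
    where open ≡-Reasoning
  ∑<-δℚ (suc n) f {suc m} (s≤s lt) =
    trans (cong₂ _+_ (*-zeroʳ (f 0)) (∑<-δℚ n (f ∘ suc) lt)) (+-identityˡ (f (suc m)))

  ∑<-δℚ-outside : ∀ n (f : ℕ → ℚ) {m} → n ℕ.≤ m → ∑< n (λ i → f i * δℚ i m) ≡ 0ℚ
  ∑<-δℚ-outside zero    f le = refl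
  ∑<-δℚ-outside (suc n) f {suc m} (s≤s le) =
    trans (cong₂ _+_ (*-zeroʳ (f 0)) (∑<-δℚ-outside n (f ∘ suc) le)) (+-identityˡ 0ℚ)

  δℚ-∸ : ∀ {i k} j → i ℕ.≤ k → δℚ (k ℕ.∸ i) j ≡ δℚ k (i ℕ.+ j)
  δℚ-∸ j z≤n      = refl
  δℚ-∸ j (s≤s le) = δℚ-∸ j le

  δℚ-< : ∀ {k i} j → k ℕ.< i → δℚ k (i ℕ.+ j) ≡ 0ℚ
  δℚ-< {zero}  {suc i} j lt       = refl
  δℚ-< {suc k} {suc i} j (s≤s lt) = δℚ-< j lt

  ∑<-unit : ∀ k (f : ℕ → ℚ) i j → ∑< (suc k) (λ i′ → f i′ * unit i′ (k ℕ.∸ i′) i j) ≡ f i * δℚ k (i ℕ.+ j)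
  ∑<-unit k f i j = trans (∑<-cong (suc k) (λ i′ _ → rearrange (f i′) (δℚ i′ i) (δℚ (k ℕ.∸ i′) j))) cases
    where
    rearrange : ∀ x y z → x * (y * z) ≡ x * z * y
    rearrange = solve 3 (λ x y z → x :* (y :* z) := x :* z :* y) refl
    cases : ∑< (suc k) (λ i′ → f i′ * δℚ (k ℕ.∸ i′) j * δℚ i′ i) ≡ f i * δℚ k (i ℕ.+ j)
    cases with i ℕ.≤? k
    ... | yes i≤k = trans (∑<-δℚ (suc k) (λ i′ → f i′ * δℚ (k ℕ.∸ i′) j) (s≤s i≤k)) (cong (f i *_) (δℚ-∸ j i≤k))
    ... | no  i≰k = trans (∑<-δℚ-outside (suc k) (λ i′ → f i′ * δℚ (k ℕ.∸ i′) j) (ℕ.≰⇒> i≰k))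
                      (sym (trans (cong (f i *_) (δℚ-< j (ℕ.≰⇒> i≰k))) (*-zeroʳ (f i))))

  ∑ℚ-⋯ : ∀ a b f → ∑ℚ (a ⋯ b) f ≡ ∑< (suc b ℕ.∸ a) (f ∘ (a ℕ.+_))
  ∑ℚ-⋯ a b f = trans (∑ℚ-map (a ℕ.+_) (upTo (suc b ℕ.∸ a)) f) (∑ℚ-upTo (suc b ℕ.∸ a) (f ∘ (a ℕ.+_)))

  ∑ℚ-decompositions : ∀ k f → ∑ℚ (decompositions k) f ≡ ∑< (suc k) (λ i → f (i , k ℕ.∸ i))
  ∑ℚ-decompositions k f = trans (∑ℚ-map (λ i → i , k ℕ.∸ i) (0 ⋯ k) f) (∑ℚ-⋯ 0 k (λ i → f (i , k ℕ.∸ i)))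

  compositions-∑< : ∀ N n (p : ℕ → ℕ → ℕ → ℚ) F →
    compositions N (λ i j → ∑< n (λ x → p x i j)) F ≡ ∑< n (λ x → compositions N (p x) F)
  compositions-∑< N zero    p F = compositions-zero N (λ _ _ → 0ℚ) F (λ _ _ → refl)
  compositions-∑< N (suc n) p F = trans (compositions-+ N (p 0) (λ i j → ∑< n (λ x → p (suc x) i j)) F)
    (cong (compositions N (p 0) F +_) (compositions-∑< N n (p ∘ suc) F))

  module Interpolated (τ : ℚ) where

    -- The interpolated harmonic product

    α β : ℚ
    α = τ * τ - τ
    β = 1ℚ - (τ + τ)

    -- The product of two words is a linear combination of words, represented by its image under
    -- an arbitrary linear form F.
    stuffle : List ℕ → List ℕ → (List ℕ → ℚ) → ℚ
    stuffle []      w       F = F w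
    stuffle (a ∷ v) []      F = F (a ∷ v)
    stuffle (a ∷ v) (b ∷ w) F =
      stuffle v (b ∷ w) (F ∘ (a ∷_)) + stuffle (a ∷ v) w (F ∘ (b ∷_)) +
      (β * stuffle v w (F ∘ (a ℕ.+ b ∷_)) + α * stuffle v w (a ℕ.+ b ▷ F))

    stuffle-cong : ∀ v w {F G} → (∀ x → F x ≡ G x) → stuffle v w F ≡ stuffle v w G
    stuffle-cong []      w       eq = eq w
    stuffle-cong (a ∷ v) []      eq = eq _
    stuffle-cong (a ∷ v) (b ∷ w) eq = cong₂ _+_
      (cong₂ _+_ (stuffle-cong v (b ∷ w) (λ x → eq _)) (stuffle-cong (a ∷ v) w (λ x → eq _)))
      (cong₂ _+_ (cong (β *_) (stuffle-cong v w (λ x → eq _)))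
                 (cong (α *_) (stuffle-cong v w (▷-cong (a ℕ.+ b) eq))))

    stuffle-+ : ∀ v w F G → stuffle v w (λ x → F x + G x) ≡ stuffle v w F + stuffle v w G
    stuffle-+ []      w       F G = refl
    stuffle-+ (a ∷ v) []      F G = refl
    stuffle-+ (a ∷ v) (b ∷ w) F G = trans
      (cong₂ _+_
        (cong₂ _+_ (stuffle-+ v (b ∷ w) (F ∘ (a ∷_)) (G ∘ (a ∷_)))
                   (stuffle-+ (a ∷ v) w (F ∘ (b ∷_)) (G ∘ (b ∷_))))
        (cong₂ _+_
          (cong (β *_) (stuffle-+ v w (F ∘ (a ℕ.+ b ∷_)) (G ∘ (a ℕ.+ b ∷_))))
          (cong (α *_) (trans (stuffle-cong v w (▷-+ (a ℕ.+ b) F G)) (stuffle-+ v w (a ℕ.+ b ▷ F) (a ℕ.+ b ▷ G))))))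
      (rearrange (stuffle v (b ∷ w) (F ∘ (a ∷_))) (stuffle v (b ∷ w) (G ∘ (a ∷_)))
                 (stuffle (a ∷ v) w (F ∘ (b ∷_))) (stuffle (a ∷ v) w (G ∘ (b ∷_)))
                 (stuffle v w (F ∘ (a ℕ.+ b ∷_))) (stuffle v w (G ∘ (a ℕ.+ b ∷_)))
                 (stuffle v w (a ℕ.+ b ▷ F)) (stuffle v w (a ℕ.+ b ▷ G)) β α)
      where
      rearrange = solve 10 (λ p p′ q q′ r r′ s s′ b a →
        ((p :+ p′) :+ (q :+ q′)) :+ (b :* (r :+ r′) :+ a :* (s :+ s′)) :=
        (p :+ q :+ (b :* r :+ a :* s)) :+ (p′ :+ q′ :+ (b :* r′ :+ a :* s′))) refl

    stuffle-* : ∀ c v w F → stuffle v w (λ x → c * F x) ≡ c * stuffle v w F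
    stuffle-* c []      w       F = refl
    stuffle-* c (a ∷ v) []      F = refl
    stuffle-* c (a ∷ v) (b ∷ w) F = trans
      (cong₂ _+_
        (cong₂ _+_ (stuffle-* c v (b ∷ w) (F ∘ (a ∷_))) (stuffle-* c (a ∷ v) w (F ∘ (b ∷_))))
        (cong₂ _+_
          (cong (β *_) (stuffle-* c v w (F ∘ (a ℕ.+ b ∷_))))
          (cong (α *_) (trans (stuffle-cong v w (▷-* (a ℕ.+ b) c F)) (stuffle-* c v w (a ℕ.+ b ▷ F))))))
      (rearrange c (stuffle v (b ∷ w) (F ∘ (a ∷_))) (stuffle (a ∷ v) w (F ∘ (b ∷_)))
                 (stuffle v w (F ∘ (a ℕ.+ b ∷_))) (stuffle v w (a ℕ.+ b ▷ F)) β α)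
      where
      rearrange = solve 7 (λ c p q r s b a →
        (c :* p :+ c :* q) :+ (b :* (c :* r) :+ a :* (c :* s)) :=
        c :* (p :+ q :+ (b :* r :+ a :* s))) refl

    stuffle-comm : ∀ v w F → stuffle v w F ≡ stuffle w v F
    stuffle-comm []      []      F = refl
    stuffle-comm []      (b ∷ w) F = refl
    stuffle-comm (a ∷ v) []      F = refl
    stuffle-comm (a ∷ v) (b ∷ w) F = cong₂ _+_
      (trans (cong₂ _+_ (stuffle-comm v (b ∷ w) (F ∘ (a ∷_))) (stuffle-comm (a ∷ v) w (F ∘ (b ∷_))))
             (+-comm (stuffle (b ∷ w) v (F ∘ (a ∷_))) (stuffle w (a ∷ v) (F ∘ (b ∷_)))))
      (cong₂ _+_
        (cong (β *_) (trans (stuffle-comm v w (F ∘ (a ℕ.+ b ∷_)))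
                            (cong (λ s → stuffle w v (F ∘ (s ∷_))) (ℕ.+-comm a b))))
        (cong (α *_) (trans (stuffle-comm v w (a ℕ.+ b ▷ F))
                            (cong (λ s → stuffle w v (s ▷ F)) (ℕ.+-comm a b)))))

    stuffle-zero : ∀ v w {F} → (∀ x → F x ≡ 0ℚ) → stuffle v w F ≡ 0ℚ
    stuffle-zero v w {F} eq = begin
      stuffle v w F                    ≡⟨ stuffle-cong v w (λ x → trans (eq x) (sym (*-zeroˡ (F x)))) ⟩
      stuffle v w (λ x → 0ℚ * F x)     ≡⟨ stuffle-* 0ℚ v w F ⟩
      0ℚ * stuffle v w F               ≡⟨ *-zeroˡ (stuffle v w F) ⟩
      0ℚ                               ∎
      where open ≡-Reasoning

    -- The words in which the letter u of stuffle (ones n) (u ∷ ones v) ends up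
    -- after l + 1 ones, or is merged with the last of them, and possibly with the next letter too.
    insertion : ℕ → ℕ → (List ℕ → ℚ) → List ℕ → ℚ
    insertion l u F x =
      F (replicate (suc l) 1 ++ u ∷ x) + β * F (replicate l 1 ++ u ℕ.+ 1 ∷ x) +
      α * (u ℕ.+ 1 ▷ (F ∘ (replicate l 1 ++_))) x

    -- The words are sorted by the number of ones used up when u is read. Placing u after the one
    -- numbered l + 1 or merging it with that one leaves the same product of `w` with n - l - 1
    -- ones, so a single form `insertion l u F` serves all the cases; this is the origin of the
    -- bracket in the theorem. The last summand has u in front of all ones.
    stuffle-ones-∷ : ∀ n u w F →
      stuffle (replicate n 1) (u ∷ w) F ≡
      ∑< n (λ l → stuffle w (replicate (n ℕ.∸ suc l) 1) (insertion l u F)) +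
      stuffle (replicate n 1) w (F ∘ (u ∷_))
    stuffle-ones-∷ zero    u w F = sym (+-identityˡ _)
    stuffle-ones-∷ (suc n) u w F = begin
      stuffle ns (u ∷ w) F₁ + stuffle (1 ∷ ns) w Fᵤ + (β * P + α * Q)
        ≡⟨ cong (λ z → z + stuffle (1 ∷ ns) w Fᵤ + (β * P + α * Q)) (stuffle-ones-∷ n u w F₁) ⟩
      R + S + stuffle (1 ∷ ns) w Fᵤ + (β * P + α * Q)
        -- `S`, the boundary term of the induction hypothesis with u right after the 1 just read,
        -- joins the merged terms `P` and `Q`: all three involve the product of `ns` and `w`.
        ≡⟨ solve 7 (λ b a p q r s z → r :+ s :+ z :+ (b :* p :+ a :* q) := (s :+ b :* p :+ a :* q) :+ r :+ z) refl β α P Q R S (stuffle (1 ∷ ns) w Fᵤ) ⟩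
      (S + β * P + α * Q) + R + stuffle (1 ∷ ns) w Fᵤ
        ≡⟨ cong (λ z → z + R + stuffle (1 ∷ ns) w Fᵤ) first ⟨
      stuffle w ns (insertion 0 u F) + R + stuffle (1 ∷ ns) w Fᵤ
        ≡⟨ cong (λ z → stuffle w ns (insertion 0 u F) + z + stuffle (1 ∷ ns) w Fᵤ)
             (∑<-cong n (λ l _ → stuffle-cong w (replicate (n ℕ.∸ suc l) 1) (shift l))) ⟩
      ∑< (suc n) (λ l → stuffle w (replicate (suc n ℕ.∸ suc l) 1) (insertion l u F)) + stuffle (1 ∷ ns) w Fᵤ
        ∎
      where
      open ≡-Reasoning
      ns = replicate n 1
      F₁ = F ∘ (1 ∷_)
      Fᵤ = F ∘ (u ∷_)
      P = stuffle ns w (F ∘ (1 ℕ.+ u ∷_))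
      Q = stuffle ns w (1 ℕ.+ u ▷ F)
      R = ∑< n (λ l → stuffle w (replicate (n ℕ.∸ suc l) 1) (insertion l u F₁))
      S = stuffle ns w (F₁ ∘ (u ∷_))
      shift : ∀ l x → insertion l u F₁ x ≡ insertion (suc l) u F x
      shift l []      = refl
      shift l (c ∷ x) = refl
      first : stuffle w ns (insertion 0 u F) ≡ S + β * P + α * Q
      first = begin
        stuffle w ns (insertion 0 u F)
          ≡⟨ stuffle-comm w ns _ ⟩
        stuffle ns w (insertion 0 u F)
          ≡⟨ stuffle-cong ns w unmerge ⟩
        stuffle ns w (λ x → F (1 ∷ u ∷ x) + β * F (1 ℕ.+ u ∷ x) + α * (1 ℕ.+ u ▷ F) x)
          ≡⟨ stuffle-+ ns w (λ x → F (1 ∷ u ∷ x) + β * F (1 ℕ.+ u ∷ x)) (λ x → α * (1 ℕ.+ u ▷ F) x) ⟩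
        stuffle ns w (λ x → F (1 ∷ u ∷ x) + β * F (1 ℕ.+ u ∷ x)) + stuffle ns w (λ x → α * (1 ℕ.+ u ▷ F) x)
          ≡⟨ cong₂ _+_ (stuffle-+ ns w (λ x → F (1 ∷ u ∷ x)) (λ x → β * F (1 ℕ.+ u ∷ x))) (stuffle-* α ns w (1 ℕ.+ u ▷ F)) ⟩
        S + stuffle ns w (λ x → β * F (1 ℕ.+ u ∷ x)) + α * Q
          ≡⟨ cong (λ z → S + z + α * Q) (stuffle-* β ns w (F ∘ (1 ℕ.+ u ∷_))) ⟩
        S + β * P + α * Q ∎
        where
        unmerge : ∀ x → insertion 0 u F x ≡ F (1 ∷ u ∷ x) + β * F (1 ℕ.+ u ∷ x) + α * (1 ℕ.+ u ▷ F) x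
        unmerge []      rewrite ℕ.+-comm u 1 = refl
        unmerge (c ∷ x) rewrite ℕ.+-comm u 1 = refl

    -- Products of two strings of ones

    weight : ℕ → ℕ → ℕ → ℕ → ℚ
    weight n v i j = coefficient n v (i ℕ.+ j) × (α ^ i * β ^ j)

    ×-*-comm : ∀ n c x y → n × (x * (c * y)) ≡ c * (n × (x * y))
    ×-*-comm n c x y = trans (cong (n ×_) (solve 3 (λ c x y → x :* (c :* y) := c :* (x :* y)) refl c x y)) (sym (×-comm-* n c (x * y)))

    -- Both sides obey the same recursion in the first letter. A letter 1 comes from either factor,
    -- which is Pascal's rule for `coefficient`. A letter 2, or one of at least 3, comes from
    -- merging two ones with coefficient β or α; this uses up one factor xy, in agreement with
    -- `coefficient (suc n) (suc v) (suc k)` being `coefficient n v k`.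
    stuffle-ones : ∀ n v F →
      stuffle (replicate n 1) (replicate v 1) F ≡ compositions (n ℕ.+ v) (weight n v) F
    stuffle-ones zero v F = sym (compositions-ones v (weight 0 v) F refl
      (λ i j → cong (λ k → coefficient 0 v k × (α ^ i * β ^ suc j)) (ℕ.+-suc i j)) (λ i j → refl))
    stuffle-ones (suc n) zero F = sym (trans
      (compositions-ones (suc n ℕ.+ 0) (weight (suc n) 0) F
        (cong (_× 1ℚ) (trans (cong (_C suc n) (ℕ.+-identityʳ (suc n))) (ℕ.nCn≡1 (suc n))))
        (λ i j → cong (λ k → coefficient (suc n) 0 k × (α ^ i * β ^ suc j)) (ℕ.+-suc i j)) (λ i j → refl))
      (cong (λ k → F (replicate k 1)) (ℕ.+-identityʳ (suc n))))
    stuffle-ones (suc n) (suc v) F = begin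
      stuffle (replicate n 1) (replicate (suc v) 1) F₁ + stuffle (replicate (suc n) 1) (replicate v 1) F₁ +
      (β * stuffle (replicate n 1) (replicate v 1) F₂ + α * stuffle (replicate n 1) (replicate v 1) (2 ▷ F))
        ≡⟨ cong₂ _+_ (cong₂ _+_ (stuffle-ones n (suc v) F₁) (stuffle-ones (suc n) v F₁))
             (cong₂ _+_ (cong (β *_) (stuffle-ones n v F₂)) (cong (α *_) (stuffle-ones n v (2 ▷ F)))) ⟩
      compositions (n ℕ.+ suc v) (weight n (suc v)) F₁ + compositions (suc (n ℕ.+ v)) (weight (suc n) v) F₁ +
      (β * compositions (n ℕ.+ v) (weight n v) F₂ + α * compositions (n ℕ.+ v) (weight n v) (2 ▷ F))
        ≡⟨ cong₂ _+_ first (cong₂ _+_ second third) ⟨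
      compositions (suc (n ℕ.+ v)) w F₁ +
      (compositions (n ℕ.+ v) (λ i j → w i (suc j)) F₂ + compositions (n ℕ.+ v) (λ i j → w (suc i) j) (2 ▷ F))
        ≡⟨ cong (λ N → compositions (suc N) w F) (ℕ.+-suc n v) ⟨
      compositions (suc (n ℕ.+ suc v)) w F ∎
      where
      open ≡-Reasoning
      F₁ = F ∘ (1 ∷_)
      F₂ = F ∘ (2 ∷_)
      w = weight (suc n) (suc v)
      first : compositions (suc (n ℕ.+ v)) w F₁ ≡
              compositions (n ℕ.+ suc v) (weight n (suc v)) F₁ + compositions (suc (n ℕ.+ v)) (weight (suc n) v) F₁
      first = begin
        compositions (suc (n ℕ.+ v)) w F₁
          ≡⟨ compositions-cong (suc (n ℕ.+ v)) F₁ (λ i j le →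
               trans (cong (_× (α ^ i * β ^ j)) (coefficient-pascal n v (i ℕ.+ j) le))
                     (×-homo-+ (α ^ i * β ^ j) (coefficient n (suc v) (i ℕ.+ j)) (coefficient (suc n) v (i ℕ.+ j)))) ⟩
        compositions (suc (n ℕ.+ v)) (λ i j → weight n (suc v) i j + weight (suc n) v i j) F₁
          ≡⟨ compositions-+ (suc (n ℕ.+ v)) (weight n (suc v)) (weight (suc n) v) F₁ ⟩
        compositions (suc (n ℕ.+ v)) (weight n (suc v)) F₁ + compositions (suc (n ℕ.+ v)) (weight (suc n) v) F₁
          ≡⟨ cong (λ N → compositions N (weight n (suc v)) F₁ + compositions (suc (n ℕ.+ v)) (weight (suc n) v) F₁) (ℕ.+-suc n v) ⟨
        compositions (n ℕ.+ suc v) (weight n (suc v)) F₁ + compositions (suc (n ℕ.+ v)) (weight (suc n) v) F₁ ∎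
      second : compositions (n ℕ.+ v) (λ i j → w i (suc j)) F₂ ≡ β * compositions (n ℕ.+ v) (weight n v) F₂
      second = trans
        (compositions-cong (n ℕ.+ v) F₂ (λ i j _ →
          trans (cong (λ k → coefficient (suc n) (suc v) k × (α ^ i * (β * β ^ j))) (ℕ.+-suc i j))
                (×-*-comm (coefficient n v (i ℕ.+ j)) β (α ^ i) (β ^ j))))
        (compositions-* β (n ℕ.+ v) (weight n v) F₂)
      third : compositions (n ℕ.+ v) (λ i j → w (suc i) j) (2 ▷ F) ≡ α * compositions (n ℕ.+ v) (weight n v) (2 ▷ F)
      third = trans
        (compositions-cong (n ℕ.+ v) (2 ▷ F) (λ i j _ →
          trans (cong (coefficient n v (i ℕ.+ j) ×_) (*-assoc α (α ^ i) (β ^ j)))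
                (sym (×-comm-* (coefficient n v (i ℕ.+ j)) α (α ^ i * β ^ j)))))
        (compositions-* α (n ℕ.+ v) (weight n v) (2 ▷ F))

    -- The shape shared by the three sums of the theorem, with the bracket replaced by a linear form
    -- in the word a₁ ⋯ a_N.
    onesProduct : ℕ → ℕ → ℕ → ℕ → (List ℕ → ℚ) → ℚ
    onesProduct K W M n F =
      ∑ℚ (0 ⋯ K) λ k → ∑ℚ (decompositions k) λ (i , j) → ∑ℚ (𝒜 (W ℕ.∸ i ℕ.∸ k) M j) λ a →
        ((W ℕ.∸ 2 ℕ.* k) C (n ℕ.∸ k)) × (α ^ i * β ^ j * F (values a))

    -- With j = k - i, 2 i + j is i + k, so the length in the theorem is the one that
    -- `∑tuples-compositions` demands. The bounds give i + k ≤ v + n, which makes the truncated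
    -- subtractions exact.
    length-formula : ∀ n v k i → k ℕ.≤ n ℕ.⊓ v → i ℕ.≤ k →
      v ℕ.+ n ℕ.∸ i ℕ.∸ k ℕ.+ (i ℕ.* 2 ℕ.+ (k ℕ.∸ i)) ≡ n ℕ.+ v
    length-formula n v k i k≤ i≤k = begin
      v ℕ.+ n ℕ.∸ i ℕ.∸ k ℕ.+ (i ℕ.* 2 ℕ.+ (k ℕ.∸ i))     ≡⟨ cong₂ ℕ._+_ (ℕ.∸-+-assoc (v ℕ.+ n) i k) i+k ⟩
      v ℕ.+ n ℕ.∸ (i ℕ.+ k) ℕ.+ (i ℕ.+ k)                 ≡⟨ ℕ.m∸n+n≡m (ℕ.+-mono-≤ (ℕ.≤-trans i≤k (ℕ.m≤n⊓o⇒m≤o n v k≤)) (ℕ.m≤n⊓o⇒m≤n n v k≤)) ⟩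
      v ℕ.+ n                                             ≡⟨ ℕ.+-comm v n ⟩
      n ℕ.+ v                                             ∎
      where
      open ≡-Reasoning
      i+k : i ℕ.* 2 ℕ.+ (k ℕ.∸ i) ≡ i ℕ.+ k
      i+k = begin
        i ℕ.* 2 ℕ.+ (k ℕ.∸ i)           ≡⟨ cong (ℕ._+ (k ℕ.∸ i)) (trans (ℕ.*-comm i 2) (cong (i ℕ.+_) (ℕ.+-identityʳ i))) ⟩
        i ℕ.+ i ℕ.+ (k ℕ.∸ i)           ≡⟨ ℕ.+-assoc i i (k ℕ.∸ i) ⟩
        i ℕ.+ (i ℕ.+ (k ℕ.∸ i))         ≡⟨ cong (i ℕ.+_) (ℕ.m+[n∸m]≡n i≤k) ⟩
        i ℕ.+ k                         ∎

    -- The sums over k and i are moved into the coefficient of a composition, where only the term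
    -- with k = i + j survives.
    onesProduct≡stuffle : ∀ n v F →
      onesProduct (n ℕ.⊓ v) (v ℕ.+ n) (n ℕ.+ v) n F ≡ stuffle (replicate n 1) (replicate v 1) F
    onesProduct≡stuffle n v F = begin
      onesProduct K W M n F
        ≡⟨ ∑ℚ-⋯ 0 K (λ k → ∑ℚ (decompositions k) (term k)) ⟩
      ∑< (suc K) (λ k → ∑ℚ (decompositions k) (term k))
        ≡⟨ ∑<-cong (suc K) (λ k k< → trans (∑ℚ-decompositions k (term k))
             (∑<-cong (suc k) (λ i i< → term≡ k i (ℕ.s≤s⁻¹ k<) (ℕ.s≤s⁻¹ i<)))) ⟩
      ∑< (suc K) (λ k → ∑< (suc k) (λ i → compositions M (λ i′ j′ → g k i * unit i (k ℕ.∸ i) i′ j′) F))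
        ≡⟨ ∑<-cong (suc K) (λ k _ → compositions-∑< M (suc k) (λ i i′ j′ → g k i * unit i (k ℕ.∸ i) i′ j′) F) ⟨
      ∑< (suc K) (λ k → compositions M (λ i′ j′ → ∑< (suc k) (λ i → g k i * unit i (k ℕ.∸ i) i′ j′)) F)
        ≡⟨ compositions-∑< M (suc K) (λ k i′ j′ → ∑< (suc k) (λ i → g k i * unit i (k ℕ.∸ i) i′ j′)) F ⟨
      compositions M (λ i′ j′ → ∑< (suc K) (λ k → ∑< (suc k) (λ i → g k i * unit i (k ℕ.∸ i) i′ j′))) F
        ≡⟨ compositions-cong M F (λ i j _ → trans (∑<-cong (suc K) {g = λ k → g k i * δℚ k (i ℕ.+ j)} (λ k _ → ∑<-unit k (g k) i j)) (collect i j)) ⟩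
      compositions M (weight n v) F
        ≡⟨ stuffle-ones n v F ⟨
      stuffle (replicate n 1) (replicate v 1) F ∎
      where
      open ≡-Reasoning
      K = n ℕ.⊓ v
      W = v ℕ.+ n
      M = n ℕ.+ v
      term : ℕ → ℕ Product.× ℕ → ℚ
      term k (i , j) = ∑ℚ (𝒜 (W ℕ.∸ i ℕ.∸ k) M j) λ a →
        ((W ℕ.∸ 2 ℕ.* k) C (n ℕ.∸ k)) × (α ^ i * β ^ j * F (values a))
      g : ℕ → ℕ → ℚ
      g k i = ((W ℕ.∸ 2 ℕ.* k) C (n ℕ.∸ k)) × (α ^ i * β ^ (k ℕ.∸ i))
      term≡ : ∀ k i → k ℕ.≤ K → i ℕ.≤ k →
        term k (i , k ℕ.∸ i) ≡ compositions M (λ i′ j′ → g k i * unit i (k ℕ.∸ i) i′ j′) F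
      term≡ k i k≤ i≤ = begin
        term k (i , j)
          ≡⟨ ∑ℚ-cong (𝒜 N M j) (λ a → sym (×-assoc-* ((W ℕ.∸ 2 ℕ.* k) C (n ℕ.∸ k)) (α ^ i * β ^ j) (F (values a)))) ⟩
        ∑ℚ (𝒜 N M j) (λ a → g k i * F (values a))
          ≡⟨ ∑ℚ-* (g k i) (𝒜 N M j) (F ∘ values) ⟩
        g k i * ∑ℚ (𝒜 N M j) (F ∘ values)
          ≡⟨ cong (g k i *_) (trans (∑𝒜 N M j F) (∑tuples-compositions M N i j F ℕ.≤-refl (length-formula n v k i k≤ i≤))) ⟩
        g k i * compositions M (unit i j) F
          ≡⟨ compositions-* (g k i) M (unit i j) F ⟨
        compositions M (λ i′ j′ → g k i * unit i j i′ j′) F ∎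
        where
        j = k ℕ.∸ i
        N = W ℕ.∸ i ℕ.∸ k
      collect : ∀ i j → ∑< (suc K) (λ k → g k i * δℚ k (i ℕ.+ j)) ≡ weight n v i j
      collect i j with i ℕ.+ j ℕ.≤? K
      ... | yes le = trans (∑<-δℚ (suc K) (λ k → g k i) (s≤s le))
                       (cong₂ (λ c l → c × (α ^ i * β ^ l)) (sym (coefficient-C n v (i ℕ.+ j) le)) (ℕ.m+n∸m≡n i j))
      -- The sum over k never reaches i + j here, and (xy)ⁱ⁺ʲ does not divide xⁿyᵛ, so both sides
      -- are 0.
      ... | no  nle = trans (∑<-δℚ-outside (suc K) (λ k → g k i) (ℕ.≰⇒> nle))
                       (cong (_× (α ^ i * β ^ j)) (sym (coefficient-zero n v (i ℕ.+ j) (ℕ.≰⇒> nle))))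

    -- Truncated interpolated multiple zeta values

    -- The sum of `F` over all mergings of the word, each plus sign weighted by τ. Passing the
    -- prefix into `F` makes linearity a structural induction.
    interpolate : (List ℕ → ℚ) → ℕ → List ℕ → ℚ
    interpolate F k []       = F (k ∷ [])
    interpolate F k (l ∷ ls) = interpolate (F ∘ (k ∷_)) l ls + τ * interpolate F (k ℕ.+ l) ls

    -- Only nonempty words are ever reached. The restriction matters at M = 0, where `partialSum` is
    -- 1 on the empty word and 0 on all others.
    interpolate-cong : ∀ k ls {F G} → (∀ k ls → F (k ∷ ls) ≡ G (k ∷ ls)) → interpolate F k ls ≡ interpolate G k ls
    interpolate-cong k []       eq = eq k []
    interpolate-cong k (l ∷ ls) eq = cong₂ _+_ (interpolate-cong l ls (λ _ _ → eq k _))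
      (cong (τ *_) (interpolate-cong (k ℕ.+ l) ls eq))

    interpolate-+ : ∀ k ls F G → interpolate (λ w → F w + G w) k ls ≡ interpolate F k ls + interpolate G k ls
    interpolate-+ k []       F G = refl
    interpolate-+ k (l ∷ ls) F G = trans
      (cong₂ _+_ (interpolate-+ l ls (F ∘ (k ∷_)) (G ∘ (k ∷_))) (cong (τ *_) (interpolate-+ (k ℕ.+ l) ls F G)))
      (solve 5 (λ t a b c d → (a :+ b) :+ t :* (c :+ d) := (a :+ t :* c) :+ (b :+ t :* d)) refl
        τ (interpolate (F ∘ (k ∷_)) l ls) (interpolate (G ∘ (k ∷_)) l ls) (interpolate F (k ℕ.+ l) ls) (interpolate G (k ℕ.+ l) ls))

    interpolate-* : ∀ c k ls F → interpolate (λ w → c * F w) k ls ≡ c * interpolate F k ls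
    interpolate-* c k []       F = refl
    interpolate-* c k (l ∷ ls) F = trans
      (cong₂ _+_ (interpolate-* c l ls (F ∘ (k ∷_))) (cong (τ *_) (interpolate-* c (k ℕ.+ l) ls F)))
      (solve 4 (λ t c a b → c :* a :+ t :* (c :* b) := c :* (a :+ t :* b)) refl
        τ c (interpolate (F ∘ (k ∷_)) l ls) (interpolate F (k ℕ.+ l) ls))

    -- The truncation m₁ ≤ M of ζᵗ, at t = τ.
    truncated : ℕ → List ℕ → ℚ
    truncated M []       = 1ℚ
    truncated M (k ∷ ks) = interpolate (λ w → partialSum w M) k ks

    -- The part of truncated (suc M) with m₁ = suc M.
    top : ℕ → List ℕ → ℚ
    top M []       = 0ℚ
    top M (k ∷ ks) = (ℤ.+ 1 / suc M) ^ k * (truncated M ks + τ * top M ks)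

    ^-+ : ∀ x a b → x ^ (a ℕ.+ b) ≡ x ^ a * x ^ b
    ^-+ x zero    b = sym (*-identityˡ (x ^ b))
    ^-+ x (suc a) b = trans (cong (x *_) (^-+ x a b)) (sym (*-assoc x (x ^ a) (x ^ b)))

    top-merge : ∀ M a b w → top M (a ℕ.+ b ∷ w) ≡ (ℤ.+ 1 / suc M) ^ a * top M (b ∷ w)
    top-merge M a b w = trans (cong (_* (truncated M w + τ * top M w)) (^-+ (ℤ.+ 1 / suc M) a b))
      (*-assoc ((ℤ.+ 1 / suc M) ^ a) ((ℤ.+ 1 / suc M) ^ b) (truncated M w + τ * top M w))

    leading : ℕ → List ℕ → ℚ
    leading M []       = 0ℚ
    leading M (k ∷ ks) = (ℤ.+ 1 / suc M) ^ k * partialSum ks M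

    -- With m₁ = M + 1, a comma after k truncates the rest at M, while a plus sign lets the next
    -- entry share m₁ and costs a factor τ.
    interpolate-leading : ∀ M k ks → interpolate (leading M) k ks ≡ top M (k ∷ ks)
    interpolate-leading M k []       = cong ((ℤ.+ 1 / suc M) ^ k *_) (solve 1 (λ t → con 1ℚ := con 1ℚ :+ t :* con 0ℚ) refl τ)
    interpolate-leading M k (l ∷ ls) = begin
      interpolate (λ w → x ^ k * partialSum w M) l ls + τ * interpolate (leading M) (k ℕ.+ l) ls
        ≡⟨ cong₂ _+_ (interpolate-* (x ^ k) l ls (λ w → partialSum w M))
             (cong (τ *_) (trans (interpolate-leading M (k ℕ.+ l) ls) (top-merge M k l ls))) ⟩
      x ^ k * truncated M (l ∷ ls) + τ * (x ^ k * top M (l ∷ ls))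
        ≡⟨ solve 4 (λ t c a b → c :* a :+ t :* (c :* b) := c :* (a :+ t :* b)) refl
             τ (x ^ k) (truncated M (l ∷ ls)) (top M (l ∷ ls)) ⟩
      x ^ k * (truncated M (l ∷ ls) + τ * top M (l ∷ ls)) ∎
      where
      open ≡-Reasoning
      x = ℤ.+ 1 / suc M

    truncated-suc : ∀ M w → truncated (suc M) w ≡ truncated M w + top M w
    truncated-suc M []       = sym (+-identityʳ 1ℚ)
    truncated-suc M (k ∷ ks) = trans
      (trans (interpolate-cong k ks (λ _ _ → refl)) (interpolate-+ k ks (λ w → partialSum w M) (leading M)))
      (cong (truncated M (k ∷ ks) +_) (interpolate-leading M k ks))

    truncated-zero : ∀ k ks → truncated 0 (k ∷ ks) ≡ 0ℚ
    truncated-zero k ks = begin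
      interpolate (λ w → partialSum w 0) k ks         ≡⟨ interpolate-cong k ks (λ _ _ → refl) ⟩
      interpolate (λ w → 0ℚ * 0ℚ) k ks                ≡⟨ interpolate-* 0ℚ k ks (λ _ → 0ℚ) ⟩
      0ℚ * interpolate (λ _ → 0ℚ) k ks                ≡⟨ *-zeroˡ (interpolate (λ _ → 0ℚ) k ks) ⟩
      0ℚ                                              ∎
      where open ≡-Reasoning

    IsCharacter : (List ℕ → ℚ) → Set
    IsCharacter S = ∀ v w → S v * S w ≡ stuffle v w S

    -- The left side is the increment of the product of truncated values from M to M + 1. In the
    -- inductive step, with x = 1 / (M + 1) and `X` the left side for the tails, the two unmerged
    -- branches leave x^(a + b) (β S(v) S(w) - τ² X) uncovered. The merged branches supply x^(a + b)
    -- (β (S(v) S(w) + τ X) + α X), and α = -τ² - τβ makes the two agree.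
    top-stuffle : ∀ M → IsCharacter (truncated M) → ∀ v w →
      top M v * truncated M w + truncated M v * top M w + top M v * top M w ≡ stuffle v w (top M)
    top-stuffle M ch [] w =
      solve 2 (λ s t → con 0ℚ :* s :+ con 1ℚ :* t :+ con 0ℚ :* t := t) refl (truncated M w) (top M w)
    top-stuffle M ch (a ∷ v) [] =
      solve 2 (λ s t → t :* con 1ℚ :+ s :* con 0ℚ :+ t :* con 0ℚ := t) refl (truncated M (a ∷ v)) (top M (a ∷ v))
    top-stuffle M ch (a ∷ v) (b ∷ w) = sym (begin
      stuffle v (b ∷ w) (T ∘ (a ∷_)) + stuffle (a ∷ v) w (T ∘ (b ∷_)) +
      (β * stuffle v w (T ∘ (a ℕ.+ b ∷_)) + α * stuffle v w (a ℕ.+ b ▷ T))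
        ≡⟨ cong₂ _+_ (cong₂ _+_ (prefix v (b ∷ w) (x ^ a) (ch v (b ∷ w)) (top-stuffle M ch v (b ∷ w)))
                                (prefix (a ∷ v) w (x ^ b) (ch (a ∷ v) w) (top-stuffle M ch (a ∷ v) w)))
                     (cong₂ _+_ (cong (β *_) (prefix v w (x ^ (a ℕ.+ b)) (ch v w) (top-stuffle M ch v w)))
                                (cong (α *_) (trans (trans (stuffle-cong v w merge) (stuffle-* (x ^ (a ℕ.+ b)) v w T))
                                                    (cong (x ^ (a ℕ.+ b) *_) (sym (top-stuffle M ch v w)))))) ⟩
      x ^ a * (S v * S (b ∷ w) + τ * (T v * S (b ∷ w) + S v * T (b ∷ w) + T v * T (b ∷ w))) +
      x ^ b * (S (a ∷ v) * S w + τ * (T (a ∷ v) * S w + S (a ∷ v) * T w + T (a ∷ v) * T w)) +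
      (β * (x ^ (a ℕ.+ b) * (S v * S w + τ * X)) + α * (x ^ (a ℕ.+ b) * X))
        ≡⟨ cong (λ z → x ^ a * (S v * S (b ∷ w) + τ * (T v * S (b ∷ w) + S v * T (b ∷ w) + T v * T (b ∷ w))) +
             x ^ b * (S (a ∷ v) * S w + τ * (T (a ∷ v) * S w + S (a ∷ v) * T w + T (a ∷ v) * T w)) +
             (β * (z * (S v * S w + τ * X)) + α * (z * X))) (^-+ x a b) ⟩
      x ^ a * (S v * S (b ∷ w) + τ * (T v * S (b ∷ w) + S v * T (b ∷ w) + T v * T (b ∷ w))) +
      x ^ b * (S (a ∷ v) * S w + τ * (T (a ∷ v) * S w + S (a ∷ v) * T w + T (a ∷ v) * T w)) +
      (β * (x ^ a * x ^ b * (S v * S w + τ * X)) + α * (x ^ a * x ^ b * X))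
        ≡⟨ identity τ (x ^ a) (x ^ b) (S v) (S w) (T v) (T w) (S (a ∷ v)) (S (b ∷ w)) ⟩
      T (a ∷ v) * S (b ∷ w) + S (a ∷ v) * T (b ∷ w) + T (a ∷ v) * T (b ∷ w) ∎)
      where
      open ≡-Reasoning
      x = ℤ.+ 1 / suc M
      S = truncated M
      T = top M
      X = T v * S w + S v * T w + T v * T w
      merge : ∀ u → (a ℕ.+ b ▷ T) u ≡ x ^ (a ℕ.+ b) * T u
      merge []      = sym (*-zeroʳ (x ^ (a ℕ.+ b)))
      merge (c ∷ u) = top-merge M (a ℕ.+ b) c u
      prefix : ∀ v w c {p q} → p ≡ stuffle v w S → q ≡ stuffle v w T →
               stuffle v w (λ u → c * (S u + τ * T u)) ≡ c * (p + τ * q)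
      prefix v w c eq₁ eq₂ = trans (stuffle-* c v w (λ u → S u + τ * T u)) (cong (c *_)
        (trans (stuffle-+ v w S (λ u → τ * T u))
          (cong₂ _+_ (sym eq₁) (trans (stuffle-* τ v w T) (cong (τ *_) (sym eq₂))))))
      identity = solve 9 (λ t x y s s′ r r′ σ σ′ →
        let A = x :* (s :+ t :* r)
            B = y :* (s′ :+ t :* r′)
            Y = r :* s′ :+ s :* r′ :+ r :* r′
        in x :* (s :* σ′ :+ t :* (r :* σ′ :+ s :* B :+ r :* B)) :+
           y :* (σ :* s′ :+ t :* (A :* s′ :+ σ :* r′ :+ A :* r′)) :+
           ((con 1ℚ :- (t :+ t)) :* (x :* y :* (s :* s′ :+ t :* Y)) :+ (t :* t :- t) :* (x :* y :* Y)) :=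
           A :* σ′ :+ σ :* B :+ A :* B) refl

    truncated-character : ∀ M → IsCharacter (truncated M)
    truncated-character zero    []      w       = *-identityˡ (truncated 0 w)
    truncated-character zero    (a ∷ v) []      = *-identityʳ (truncated 0 (a ∷ v))
    truncated-character zero    (a ∷ v) (b ∷ w) = begin
      truncated 0 (a ∷ v) * truncated 0 (b ∷ w)  ≡⟨ cong (_* truncated 0 (b ∷ w)) (truncated-zero a v) ⟩
      0ℚ * truncated 0 (b ∷ w)                   ≡⟨ *-zeroˡ (truncated 0 (b ∷ w)) ⟩
      0ℚ                                         ≡⟨ cong₂ _+_ (cong₂ _+_ (stuffle-zero v (b ∷ w) (truncated-zero a)) (stuffle-zero (a ∷ v) w (truncated-zero b)))
                                                      (cong₂ _+_ (scale β (stuffle-zero v w (truncated-zero (a ℕ.+ b)))) (scale α (stuffle-zero v w ▷-zero))) ⟨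
      stuffle (a ∷ v) (b ∷ w) (truncated 0)      ∎
      where
      open ≡-Reasoning
      scale : ∀ c {x} → x ≡ 0ℚ → c * x ≡ 0ℚ
      scale c refl = *-zeroʳ c
      ▷-zero : ∀ u → (a ℕ.+ b ▷ truncated 0) u ≡ 0ℚ
      ▷-zero []      = refl
      ▷-zero (c ∷ u) = truncated-zero (a ℕ.+ b ℕ.+ c) u
    truncated-character (suc M) v w = begin
      truncated (suc M) v * truncated (suc M) w
        ≡⟨ cong₂ _*_ (truncated-suc M v) (truncated-suc M w) ⟩
      (S v + T v) * (S w + T w)
        ≡⟨ solve 4 (λ s t s′ t′ → (s :+ t) :* (s′ :+ t′) := s :* s′ :+ (t :* s′ :+ s :* t′ :+ t :* t′)) refl (S v) (T v) (S w) (T w) ⟩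
      S v * S w + (T v * S w + S v * T w + T v * T w)
        ≡⟨ cong₂ _+_ (truncated-character M v w) (top-stuffle M (truncated-character M) v w) ⟩
      stuffle v w S + stuffle v w T
        ≡⟨ stuffle-+ v w S T ⟨
      stuffle v w (λ u → S u + T u)
        ≡⟨ stuffle-cong v w (truncated-suc M) ⟨
      stuffle v w (truncated (suc M)) ∎
      where
      open ≡-Reasoning
      S = truncated M
      T = top M

  -- Evaluation of polynomials

  -- For fixed M this respects sums and products exactly, although it is not invariant under
  -- equality of reals.
  eval : ℕ → ℚ → Pol → ℚ
  eval M τ []      = 0ℚ
  eval M τ (a ∷ p) = approx a M + τ * eval M τ p

  module _ (M : ℕ) where

    coeff-+ : ∀ p q i → approx (coeff (p +ₚ q) i) M ≡ approx (coeff p i) M + approx (coeff q i) M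
    coeff-+ []      q       i       = sym (+-identityˡ _)
    coeff-+ (a ∷ p) []      i       = sym (+-identityʳ _)
    coeff-+ (a ∷ p) (b ∷ q) zero    = refl
    coeff-+ (a ∷ p) (b ∷ q) (suc i) = coeff-+ p q i

    coeff-neg : ∀ p i → approx (coeff (-ₚ p) i) M ≡ - approx (coeff p i) M
    coeff-neg []      i       = refl
    coeff-neg (a ∷ p) zero    = refl
    coeff-neg (a ∷ p) (suc i) = coeff-neg p i

    eval-bounded : ∀ p → ∃ λ B → 0ℚ ≤ B Product.× (∀ τ → ∣ τ ∣ ≤ 1ℚ → ∣ eval M τ p ∣ ≤ B)
    eval-bounded []      = 0ℚ , ≤-refl , λ _ _ → ≤-refl
    eval-bounded (a ∷ p) with eval-bounded p
    ... | B , 0≤B , bound = ∣ approx a M ∣ + B , +-mono-≤ (0≤∣p∣ (approx a M)) 0≤B , λ τ ∣τ∣≤1 → begin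
      ∣ approx a M + τ * eval M τ p ∣          ≤⟨ ∣p+q∣≤∣p∣+∣q∣ (approx a M) (τ * eval M τ p) ⟩
      ∣ approx a M ∣ + ∣ τ * eval M τ p ∣      ≡⟨ cong (∣ approx a M ∣ +_) (∣p*q∣≡∣p∣*∣q∣ τ (eval M τ p)) ⟩
      ∣ approx a M ∣ + ∣ τ ∣ * ∣ eval M τ p ∣  ≤⟨ +-monoʳ-≤ ∣ approx a M ∣ (*-monoʳ-≤-nonNeg ∣ eval M τ p ∣ {{∣-∣-nonNeg (eval M τ p)}} ∣τ∣≤1) ⟩
      ∣ approx a M ∣ + 1ℚ * ∣ eval M τ p ∣     ≡⟨ cong (∣ approx a M ∣ +_) (*-identityˡ ∣ eval M τ p ∣) ⟩
      ∣ approx a M ∣ + ∣ eval M τ p ∣          ≤⟨ +-monoʳ-≤ ∣ approx a M ∣ (bound τ ∣τ∣≤1) ⟩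
      ∣ approx a M ∣ + B                       ∎
      where open ≤-Reasoning

    no-positive-lower-bound : ∀ {c B} → 0ℚ < c → 0ℚ ≤ B → ¬ (∀ τ → 0ℚ < τ → τ ≤ 1ℚ → c ≤ τ * B)
    no-positive-lower-bound {c} {B} 0<c 0≤B bound =
      contradiction (≤-<-trans (bound τ 0<τ τ≤1) τB<c) (<-irrefl refl)
      where
      s = c + B
      0<s : 0ℚ < s
      0<s = +-mono-<-≤ 0<c 0≤B
      instance
        c-positive : Positive c
        c-positive = positive 0<c
        s-positive : Positive s
        s-positive = positive 0<s
        s-nonZero : NonZero s
        s-nonZero = pos⇒nonZero s
        1/s-positive : Positive (1/ s)
        1/s-positive = 1/pos⇒pos s
      -- With τ = c / (c + B), the product τ B is c - τ c, strictly below c.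
      τ = c * 1/ s
      0<τ : 0ℚ < τ
      0<τ = positive⁻¹ τ {{pos*pos⇒pos c (1/ s)}}
      τs≡c : τ * s ≡ c
      τs≡c = trans (*-assoc c (1/ s) s) (trans (cong (c *_) (*-inverseˡ s)) (*-identityʳ c))
      τ≤1 : τ ≤ 1ℚ
      τ≤1 = *-cancelʳ-≤-pos s (begin
        τ * s     ≡⟨ τs≡c ⟩
        c         ≡⟨ +-identityʳ c ⟨
        c + 0ℚ    ≤⟨ +-monoʳ-≤ c 0≤B ⟩
        s         ≡⟨ *-identityˡ s ⟨
        1ℚ * s    ∎)
        where open ≤-Reasoning
      τB<c : τ * B < c
      τB<c = begin-strict
        τ * B             ≡⟨ +-identityˡ (τ * B) ⟨
        0ℚ + τ * B        <⟨ +-monoˡ-< (τ * B) (positive⁻¹ (τ * c) {{pos*pos⇒pos τ {{positive 0<τ}} c}}) ⟩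
        τ * c + τ * B     ≡⟨ *-distribˡ-+ τ c B ⟨
        τ * s             ≡⟨ τs≡c ⟩
        c                 ∎
        where open ≤-Reasoning

    -- The constant term is -τ times a quantity bounded for τ ≤ 1, so it vanishes as τ tends to 0.
    -- The rest can then be divided by τ. Assuming zeros only at positive τ is what lets the
    -- induction continue, as nothing is learnt at 0 after this division.
    coeff-zero : ∀ p → (∀ τ → 0ℚ < τ → eval M τ p ≡ 0ℚ) → ∀ i → approx (coeff p i) M ≡ 0ℚ
    coeff-zero []      eq i = refl
    coeff-zero (a ∷ p) eq   = λ { zero → a≡0 ; (suc i) → coeff-zero p quotient i }
      where
      c = approx a M
      c+x≡0⇒∣c∣≡∣x∣ : ∀ {x} → c + x ≡ 0ℚ → ∣ c ∣ ≡ ∣ x ∣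
      c+x≡0⇒∣c∣≡∣x∣ {x} h = trans (cong ∣_∣ (trans (solve 2 (λ c x → c := (c :+ x) :- x) refl c x)
        (trans (cong (_- x) h) (+-identityˡ (- x))))) (∣-p∣≡∣p∣ x)
      a≡0 : c ≡ 0ℚ
      a≡0 with 0ℚ <? ∣ c ∣
      ... | no  ∣c∣≮0 = ∣p∣≡0⇒p≡0 c (≤-antisym (≮⇒≥ ∣c∣≮0) (0≤∣p∣ c))
      ... | yes 0<∣c∣ = contradiction small (no-positive-lower-bound 0<∣c∣ (proj₁ (proj₂ (eval-bounded p))))
        where
        open ≤-Reasoning
        small : ∀ τ → 0ℚ < τ → τ ≤ 1ℚ → ∣ c ∣ ≤ τ * proj₁ (eval-bounded p)
        small τ 0<τ τ≤1 = begin
          ∣ c ∣                              ≡⟨ c+x≡0⇒∣c∣≡∣x∣ (eq τ 0<τ) ⟩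
          ∣ τ * eval M τ p ∣                 ≡⟨ ∣p*q∣≡∣p∣*∣q∣ τ (eval M τ p) ⟩
          ∣ τ ∣ * ∣ eval M τ p ∣             ≡⟨ cong (_* ∣ eval M τ p ∣) (0≤p⇒∣p∣≡p (<⇒≤ 0<τ)) ⟩
          τ * ∣ eval M τ p ∣                 ≤⟨ *-monoˡ-≤-nonNeg τ {{pos⇒nonNeg τ {{positive 0<τ}}}}
                                                 (proj₂ (proj₂ (eval-bounded p)) τ (subst (_≤ 1ℚ) (sym (0≤p⇒∣p∣≡p (<⇒≤ 0<τ))) τ≤1)) ⟩
          τ * proj₁ (eval-bounded p)         ∎
      quotient : ∀ τ → 0ℚ < τ → eval M τ p ≡ 0ℚ
      quotient τ 0<τ = begin
        e                       ≡⟨ *-identityˡ e ⟨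
        1ℚ * e                  ≡⟨ cong (_* e) (*-inverseˡ τ) ⟨
        1/ τ * τ * e            ≡⟨ *-assoc (1/ τ) τ e ⟩
        1/ τ * (τ * e)          ≡⟨ cong (1/ τ *_) (+-identityˡ (τ * e)) ⟨
        1/ τ * (0ℚ + τ * e)     ≡⟨ cong (λ z → 1/ τ * (z + τ * e)) a≡0 ⟨
        1/ τ * (c + τ * e)      ≡⟨ cong (1/ τ *_) (eq τ 0<τ) ⟩
        1/ τ * 0ℚ               ≡⟨ *-zeroʳ (1/ τ) ⟩
        0ℚ                      ∎
        where
        open ≡-Reasoning
        e = eval M τ p
        instance
          τ-nonZero : NonZero τ
          τ-nonZero = pos⇒nonZero τ {{positive 0<τ}}

  -- The right-hand side of the theorem, sum by sum

  insertionTerm : ∀ (m u : ℕ≥ 2) l D {N} → Vec (ℕ≥ 1) N → Pol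
  insertionTerm m u l D a =
    ζᵗ (m , ones l ++ ↓ u ∷ toList a)
    +ₚ (1ₚ -ₚ 2 ×ₚ t) *ₚ ζᵗ (m , ones (l ℕ.∸ 1) ++ ↓ u ⊕ 1 ∷ toList a)
    +ₚ (1ₚ -ₚ D) *ₚ (t ^ₚ 2 -ₚ t) *ₚ
         splitFirst a (λ a₁ a₂⋯ → ζᵗ (m , ones (l ℕ.∸ 1) ++ ↓ u ⊕ 1 ⊕ value a₁ ∷ a₂⋯))

  mergedTerm : ∀ (m u : ℕ≥ 2) D {N} → Vec (ℕ≥ 1) N → Pol
  mergedTerm m u D a =
    ζᵗ (m , ↓ u ∷ toList a)
    +ₚ ζᵗ (u , ↓ m ∷ toList a)
    +ₚ (1ₚ -ₚ 2 ×ₚ t) *ₚ ζᵗ (m ⊕ value u , toList a)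
    +ₚ (1ₚ -ₚ D) *ₚ (t ^ₚ 2 -ₚ t) *ₚ
         splitFirst a (λ a₁ a₂⋯ → ζᵗ (m ⊕ value u ⊕ value a₁ , a₂⋯))

  -- The bounds, the lower binomial argument and the product of deltas are parameters, so that the
  -- first two sums of the theorem are instances with m, u and n, v exchanged.
  insertionSum : ∀ (m u : ℕ≥ 2) l K W V q D → Pol
  insertionSum m u l K W V q D =
    ∑[ k ← 0 ⋯ K ] ∑[ (i , j) ← decompositions k ] ∑[ a ← 𝒜 (W ℕ.∸ i ℕ.∸ k) V j ]
      ((W ℕ.∸ 2 ℕ.* k) C (q ℕ.∸ k)) ×ₚ ((t ^ₚ 2 -ₚ t) ^ₚ i *ₚ (1ₚ -ₚ 2 ×ₚ t) ^ₚ j *ₚ insertionTerm m u l D a)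

  mergedSum : ∀ (m u : ℕ≥ 2) K W V q D → Pol
  mergedSum m u K W V q D =
    ∑[ k ← 0 ⋯ K ] ∑[ (i , j) ← decompositions k ] ∑[ a ← 𝒜 (W ℕ.∸ i ℕ.∸ k) V j ]
      ((W ℕ.∸ 2 ℕ.* k) C (q ℕ.∸ k)) ×ₚ ((t ^ₚ 2 -ₚ t) ^ₚ i *ₚ (1ₚ -ₚ 2 ×ₚ t) ^ₚ j *ₚ mergedTerm m u D a)

  rightHandSide : ∀ (m u : ℕ≥ 2) (n v : ℕ) → Pol
  rightHandSide m u n v =
    ∑ (1 ⋯ n) (λ l → insertionSum m u l (v ℕ.⊓ (n ℕ.∸ l)) (v ℕ.+ n ℕ.∸ l) (n ℕ.+ v ℕ.∸ l) v (δ v 0 *ₚ δ n l))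
    +ₚ ∑ (1 ⋯ v) (λ l → insertionSum u m l (n ℕ.⊓ (v ℕ.∸ l)) (v ℕ.+ n ℕ.∸ l) (n ℕ.+ v ℕ.∸ l) n (δ n 0 *ₚ δ v l))
    +ₚ mergedSum m u (n ℕ.⊓ v) (v ℕ.+ n) (n ℕ.+ v) n (δ n 0 *ₚ δ v 0)

  -- Evaluation carries the polynomial identity to truncated values

  module Evaluated (M : ℕ) (τ : ℚ) where

    open Interpolated τ

    private
      S : List ℕ → ℚ
      S = truncated M
      ⟦_⟧ : Pol → ℚ
      ⟦_⟧ = eval M τ

    eval-+ : ∀ p q → ⟦ p +ₚ q ⟧ ≡ ⟦ p ⟧ + ⟦ q ⟧
    eval-+ []      q       = sym (+-identityˡ _)
    eval-+ (a ∷ p) []      = sym (+-identityʳ _)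
    eval-+ (a ∷ p) (b ∷ q) = trans (cong (λ z → approx a M + approx b M + τ * z) (eval-+ p q))
      (solve 5 (λ t a b p q → a :+ b :+ t :* (p :+ q) := (a :+ t :* p) :+ (b :+ t :* q)) refl
        τ (approx a M) (approx b M) ⟦ p ⟧ ⟦ q ⟧)

    eval-neg : ∀ p → ⟦ -ₚ p ⟧ ≡ - ⟦ p ⟧
    eval-neg []      = refl
    eval-neg (a ∷ p) = trans (cong (λ z → - approx a M + τ * z) (eval-neg p))
      (solve 3 (λ t a p → :- a :+ t :* (:- p) := :- (a :+ t :* p)) refl τ (approx a M) ⟦ p ⟧)

    eval-sub : ∀ p q → ⟦ p -ₚ q ⟧ ≡ ⟦ p ⟧ - ⟦ q ⟧
    eval-sub p q = trans (eval-+ p (-ₚ q)) (cong (λ z → ⟦ p ⟧ + z) (eval-neg q))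

    eval-scale : ∀ a p → ⟦ map (a *ᵣ_) p ⟧ ≡ approx a M * ⟦ p ⟧
    eval-scale a []      = sym (*-zeroʳ (approx a M))
    eval-scale a (b ∷ p) = trans (cong (λ z → approx a M * approx b M + τ * z) (eval-scale a p))
      (solve 4 (λ t a b p → a :* b :+ t :* (a :* p) := a :* (b :+ t :* p)) refl τ (approx a M) (approx b M) ⟦ p ⟧)

    eval-* : ∀ p q → ⟦ p *ₚ q ⟧ ≡ ⟦ p ⟧ * ⟦ q ⟧
    eval-* []      q = sym (*-zeroˡ ⟦ q ⟧)
    eval-* (a ∷ p) q = begin
      ⟦ map (a *ᵣ_) q +ₚ (constᵣ 0ℚ ∷ p *ₚ q) ⟧     ≡⟨ eval-+ (map (a *ᵣ_) q) (constᵣ 0ℚ ∷ p *ₚ q) ⟩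
      ⟦ map (a *ᵣ_) q ⟧ + (0ℚ + τ * ⟦ p *ₚ q ⟧)     ≡⟨ cong₂ (λ y z → y + (0ℚ + τ * z)) (eval-scale a q) (eval-* p q) ⟩
      approx a M * ⟦ q ⟧ + (0ℚ + τ * (⟦ p ⟧ * ⟦ q ⟧)) ≡⟨ solve 4 (λ t a p q → a :* q :+ (con 0ℚ :+ t :* (p :* q)) := (a :+ t :* p) :* q) refl τ (approx a M) ⟦ p ⟧ ⟦ q ⟧ ⟩
      (approx a M + τ * ⟦ p ⟧) * ⟦ q ⟧              ∎
      where open ≡-Reasoning

    eval-constant : ∀ x → ⟦ constant x ⟧ ≡ approx x M
    eval-constant x = trans (cong (approx x M +_) (*-zeroʳ τ)) (+-identityʳ (approx x M))

    eval-t : ⟦ t ⟧ ≡ τ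
    eval-t = solve 1 (λ t → con 0ℚ :+ t :* (con 1ℚ :+ t :* con 0ℚ) := t) refl τ

    eval-^ : ∀ p n → ⟦ p ^ₚ n ⟧ ≡ ⟦ p ⟧ ^ n
    eval-^ p zero    = eval-constant (constᵣ 1ℚ)
    eval-^ p (suc n) = trans (eval-* p (p ^ₚ n)) (cong (⟦ p ⟧ *_) (eval-^ p n))

    eval-× : ∀ n p → ⟦ n ×ₚ p ⟧ ≡ n × ⟦ p ⟧
    eval-× zero    p = refl
    eval-× (suc n) p = trans (eval-+ p (n ×ₚ p)) (cong (λ z → ⟦ p ⟧ + z) (eval-× n p))

    eval-∑ : ∀ {A : Set} (xs : List A) (f : A → Pol) → ⟦ ∑ xs f ⟧ ≡ ∑ℚ xs (λ x → ⟦ f x ⟧)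
    eval-∑ []       f = refl
    eval-∑ (x ∷ xs) f = trans (eval-+ (f x) (∑ xs f)) (cong (λ z → ⟦ f x ⟧ + z) (eval-∑ xs f))

    eval-α : ⟦ t ^ₚ 2 -ₚ t ⟧ ≡ α
    eval-α = trans (eval-sub (t ^ₚ 2) t) (cong₂ _-_
      (trans (eval-^ t 2) (trans (cong (λ z → z * (z * 1ℚ)) eval-t) (cong (τ *_) (*-identityʳ τ)))) eval-t)

    eval-β : ⟦ 1ₚ -ₚ 2 ×ₚ t ⟧ ≡ β
    eval-β = trans (eval-sub 1ₚ (2 ×ₚ t)) (cong₂ _-_ (eval-constant (constᵣ 1ℚ))
      (trans (eval-× 2 t) (trans (cong (λ z → z + (z + 0ℚ)) eval-t) (cong (τ +_) (+-identityʳ τ)))))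

    -- This keeps the truncated subtraction in the exponent exact, so that a plus sign contributes
    -- precisely one factor τ in `∑ℚ-mergings`.
    mergings-length : ∀ {b} (k : ℕ≥ b) ls → All (λ p → length (proj₂ p) ℕ.≤ length ls) (mergings k ls)
    mergings-length k []       = z≤n ∷ []
    mergings-length k (l ∷ ls) = All.++⁺ (All.map⁺ (All.map s≤s (mergings-length l ls)))
      (All.map ℕ.m≤n⇒m≤1+n (mergings-length (k ⊕ value l) ls))

    ∑ℚ-mergings : ∀ {b} (k : ℕ≥ b) ls F →
      ∑ℚ (mergings k ls) (λ p → τ ^ (length ls ℕ.∸ length (proj₂ p)) * F (value (proj₁ p) ∷ map value (proj₂ p))) ≡
      interpolate F (value k) (map value ls)
    ∑ℚ-mergings k []       F = trans (+-identityʳ _) (*-identityˡ (F (value k ∷ [])))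
    ∑ℚ-mergings k (l ∷ ls) F = trans (∑ℚ-++ (map (λ p → k , proj₁ p ∷ proj₂ p) (mergings l ls)) (mergings (k ⊕ value l) ls) H) (cong₂ _+_
      (trans (∑ℚ-map (λ p → k , proj₁ p ∷ proj₂ p) (mergings l ls) H) (∑ℚ-mergings l ls (F ∘ (value k ∷_))))
      (begin
        ∑ℚ (mergings (k ⊕ value l) ls) H
          ≡⟨ ∑ℚ-congᴬ (All.map (λ {p} → extract p) (mergings-length (k ⊕ value l) ls)) ⟩
        ∑ℚ (mergings (k ⊕ value l) ls) (λ p → τ * (τ ^ (length ls ℕ.∸ length (proj₂ p)) * G p))
          ≡⟨ ∑ℚ-* τ (mergings (k ⊕ value l) ls) (λ p → τ ^ (length ls ℕ.∸ length (proj₂ p)) * G p) ⟩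
        τ * ∑ℚ (mergings (k ⊕ value l) ls) (λ p → τ ^ (length ls ℕ.∸ length (proj₂ p)) * G p)
          ≡⟨ cong (τ *_) (∑ℚ-mergings (k ⊕ value l) ls F) ⟩
        τ * interpolate F (value k ℕ.+ value l) (map value ls) ∎))
      where
      open ≡-Reasoning
      G : ∀ {b} → ℕ≥ b Product.× List (ℕ≥ 1) → ℚ
      G p = F (value (proj₁ p) ∷ map value (proj₂ p))
      H : ∀ {b} → ℕ≥ b Product.× List (ℕ≥ 1) → ℚ
      H p = τ ^ (suc (length ls) ℕ.∸ length (proj₂ p)) * G p
      extract : ∀ {b} (p : ℕ≥ b Product.× List (ℕ≥ 1)) → length (proj₂ p) ℕ.≤ length ls →
        τ ^ (suc (length ls) ℕ.∸ length (proj₂ p)) * G p ≡ τ * (τ ^ (length ls ℕ.∸ length (proj₂ p)) * G p)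
      extract p le = trans (cong (λ n → τ ^ n * G p) (ℕ.+-∸-assoc 1 le))
        (*-assoc τ (τ ^ (length ls ℕ.∸ length (proj₂ p))) (G p))

    eval-ζᵗ : ∀ k ks → ⟦ ζᵗ (k , ks) ⟧ ≡ truncated M (value k ∷ map value ks)
    eval-ζᵗ k ks = trans (eval-∑ (mergings k ks) (λ p → t ^ₚ (dep (k , ks) ℕ.∸ dep p) *ₚ constant (ζ p)))
      (trans (∑ℚ-cong (mergings k ks) (λ p → trans (eval-* (t ^ₚ (dep (k , ks) ℕ.∸ dep p)) (constant (ζ p)))
        (cong₂ _*_ (trans (eval-^ t (dep (k , ks) ℕ.∸ dep p)) (cong (_^ (dep (k , ks) ℕ.∸ dep p)) eval-t)) (eval-constant (ζ p)))))
      (∑ℚ-mergings k ks (λ w → partialSum w M)))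

    map-value-ones : ∀ l x → map value (ones l ++ x) ≡ replicate l 1 ++ map value x
    map-value-ones l x = trans (map-++ value (ones l) x) (cong (_++ map value x) (map-replicate value l _))

    eval-ζᵗ-ones : ∀ (k : ℕ≥ 2) l x → ⟦ ζᵗ (k , ones l ++ x) ⟧ ≡ S (value k ∷ replicate l 1 ++ map value x)
    eval-ζᵗ-ones k l x = trans (eval-ζᵗ k (ones l ++ x)) (cong (λ w → S (value k ∷ w)) (map-value-ones l x))

    eval-δ : ∀ {i j} → i ≢ j → ⟦ δ i j ⟧ ≡ 0ℚ
    eval-δ {i} {j} i≢j = cong (λ b → ⟦ if b then 1ₚ else 0ₚ ⟧) (dec-false (i ℕ.≟ j) i≢j)

    -- If neither delta vanishes, then v = 0 and n = l, so no weight is left for the tuple. The case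
    -- l = 0 serves the third sum.
    eval-δδ : ∀ v n l → ⟦ δ v 0 *ₚ δ n l ⟧ ≡ 0ℚ ⊎ v ℕ.+ n ℕ.∸ l ≡ 0
    eval-δδ (suc v) n l = inj₁ refl
    eval-δδ zero    n l = cases (n ℕ.≟ l)
      where
      cases : Dec (n ≡ l) → ⟦ δ 0 0 *ₚ δ n l ⟧ ≡ 0ℚ ⊎ n ℕ.∸ l ≡ 0
      cases (yes n≡l) = inj₂ (trans (cong (ℕ._∸ l) n≡l) (ℕ.n∸n≡0 l))
      cases (no  n≢l) = inj₁ (trans (eval-* (δ 0 0) (δ n l)) (trans (cong (⟦ δ 0 0 ⟧ *_) (eval-δ n≢l)) (*-zeroʳ ⟦ δ 0 0 ⟧)))

    -- `splitFirst` and `▷` share the default value 0 on the empty tuple.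
    eval-splitFirst : ∀ {N} (a : Vec (ℕ≥ 1) N) f c F → (∀ x xs → ⟦ f x xs ⟧ ≡ F (c ℕ.+ value x ∷ map value xs)) →
                      ⟦ splitFirst a f ⟧ ≡ (c ▷ F) (values a)
    eval-splitFirst []      f c F eq = refl
    eval-splitFirst (x ∷ a) f c F eq = eq x (toList a)

    -- The factor 1 - D vanishes only on empty tuples, where splitFirst is 0 anyway.
    eval-factor : ∀ {N} (a : Vec (ℕ≥ 1) N) D f → ⟦ D ⟧ ≡ 0ℚ ⊎ N ≡ 0 →
                  ⟦ (1ₚ -ₚ D) *ₚ (t ^ₚ 2 -ₚ t) *ₚ splitFirst a f ⟧ ≡ α * ⟦ splitFirst a f ⟧
    eval-factor a D f cases = trans (eval-* ((1ₚ -ₚ D) *ₚ (t ^ₚ 2 -ₚ t)) (splitFirst a f)) (go a cases)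
      where
      open ≡-Reasoning
      go : ∀ {N} (a : Vec (ℕ≥ 1) N) → ⟦ D ⟧ ≡ 0ℚ ⊎ N ≡ 0 →
           ⟦ (1ₚ -ₚ D) *ₚ (t ^ₚ 2 -ₚ t) ⟧ * ⟦ splitFirst a f ⟧ ≡ α * ⟦ splitFirst a f ⟧
      go []      _           = trans (*-zeroʳ ⟦ (1ₚ -ₚ D) *ₚ (t ^ₚ 2 -ₚ t) ⟧) (sym (*-zeroʳ α))
      go (x ∷ a) (inj₁ D≡0) = cong (_* ⟦ splitFirst (x ∷ a) f ⟧) (begin
        ⟦ (1ₚ -ₚ D) *ₚ (t ^ₚ 2 -ₚ t) ⟧          ≡⟨ eval-* (1ₚ -ₚ D) (t ^ₚ 2 -ₚ t) ⟩
        ⟦ 1ₚ -ₚ D ⟧ * ⟦ t ^ₚ 2 -ₚ t ⟧           ≡⟨ cong₂ _*_ (trans (eval-sub 1ₚ D) (cong₂ _-_ (eval-constant (constᵣ 1ℚ)) D≡0)) eval-α ⟩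
        1ℚ * α                                  ≡⟨ *-identityˡ α ⟩
        α                                       ∎)

    eval-β* : ∀ p → ⟦ (1ₚ -ₚ 2 ×ₚ t) *ₚ p ⟧ ≡ β * ⟦ p ⟧
    eval-β* p = trans (eval-* (1ₚ -ₚ 2 ×ₚ t) p) (cong (_* ⟦ p ⟧) eval-β)

    eval-onesProduct : ∀ K W m n (g : ∀ k (ij : ℕ Product.× ℕ) → Vec (ℕ≥ 1) (W ℕ.∸ proj₁ ij ℕ.∸ k) → Pol) F →
      (∀ k ij a → ⟦ g k ij a ⟧ ≡ F (values a)) →
      ⟦ (∑[ k ← 0 ⋯ K ] ∑[ ij ← decompositions k ] ∑[ a ← 𝒜 (W ℕ.∸ proj₁ ij ℕ.∸ k) m (proj₂ ij) ]
           ((W ℕ.∸ 2 ℕ.* k) C (n ℕ.∸ k)) ×ₚ ((t ^ₚ 2 -ₚ t) ^ₚ proj₁ ij *ₚ (1ₚ -ₚ 2 ×ₚ t) ^ₚ proj₂ ij *ₚ g k ij a)) ⟧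
      ≡ onesProduct K W m n F
    eval-onesProduct K W m n g F eq =
      trans (eval-∑ (0 ⋯ K) (λ k → ∑ (decompositions k) (inner k))) (∑ℚ-cong (0 ⋯ K) λ k →
      trans (eval-∑ (decompositions k) (inner k)) (∑ℚ-cong (decompositions k) λ ij →
      trans (eval-∑ (𝒜 (W ℕ.∸ proj₁ ij ℕ.∸ k) m (proj₂ ij)) (term k ij)) (∑ℚ-cong (𝒜 (W ℕ.∸ proj₁ ij ℕ.∸ k) m (proj₂ ij)) λ a →
      trans (eval-× ((W ℕ.∸ 2 ℕ.* k) C (n ℕ.∸ k)) (A (proj₁ ij) *ₚ B (proj₂ ij) *ₚ g k ij a)) (cong (((W ℕ.∸ 2 ℕ.* k) C (n ℕ.∸ k)) ×_) (
      trans (eval-* (A (proj₁ ij) *ₚ B (proj₂ ij)) (g k ij a)) (cong₂ _*_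
        (trans (eval-* (A (proj₁ ij)) (B (proj₂ ij))) (cong₂ _*_
          (trans (eval-^ (t ^ₚ 2 -ₚ t) (proj₁ ij)) (cong (_^ proj₁ ij) eval-α))
          (trans (eval-^ (1ₚ -ₚ 2 ×ₚ t) (proj₂ ij)) (cong (_^ proj₂ ij) eval-β))))
        (eq k ij a)))))))
      where
      A B : ℕ → Pol
      A i = (t ^ₚ 2 -ₚ t) ^ₚ i
      B j = (1ₚ -ₚ 2 ×ₚ t) ^ₚ j
      term : ∀ k (ij : ℕ Product.× ℕ) → Vec (ℕ≥ 1) (W ℕ.∸ proj₁ ij ℕ.∸ k) → Pol
      term k ij a = ((W ℕ.∸ 2 ℕ.* k) C (n ℕ.∸ k)) ×ₚ (A (proj₁ ij) *ₚ B (proj₂ ij) *ₚ g k ij a)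
      inner : ℕ → ℕ Product.× ℕ → Pol
      inner k ij = ∑ (𝒜 (W ℕ.∸ proj₁ ij ℕ.∸ k) m (proj₂ ij)) (term k ij)

    vanishing-length : ∀ {W} i k → W ≡ 0 → W ℕ.∸ i ℕ.∸ k ≡ 0
    vanishing-length i k refl = trans (cong (ℕ._∸ k) (ℕ.0∸n≡0 i)) (ℕ.0∸n≡0 k)

    length-cases : ∀ {W D} i k → ⟦ D ⟧ ≡ 0ℚ ⊎ W ≡ 0 → ⟦ D ⟧ ≡ 0ℚ ⊎ W ℕ.∸ i ℕ.∸ k ≡ 0
    length-cases i k (inj₁ D≡0) = inj₁ D≡0
    length-cases i k (inj₂ W≡0) = inj₂ (vanishing-length i k W≡0)

    eval-insertionTerm : ∀ m u l D {N} (a : Vec (ℕ≥ 1) N) → ⟦ D ⟧ ≡ 0ℚ ⊎ N ≡ 0 →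
      ⟦ insertionTerm m u (suc l) D a ⟧ ≡ insertion l (value u) (S ∘ (value m ∷_)) (values a)
    eval-insertionTerm m u l D a cases = trans
      (trans (eval-+ (p +ₚ (1ₚ -ₚ 2 ×ₚ t) *ₚ q) r) (cong (_+ ⟦ r ⟧) (eval-+ p ((1ₚ -ₚ 2 ×ₚ t) *ₚ q))))
      (cong₂ _+_
        (cong₂ _+_ (eval-ζᵗ-ones m (suc l) (↓ u ∷ toList a))
                   (trans (eval-β* q) (cong (β *_) (eval-ζᵗ-ones m l (↓ u ⊕ 1 ∷ toList a)))))
        (trans (eval-factor a D f cases) (cong (α *_)
          (eval-splitFirst a f (value u ℕ.+ 1) (λ w → S (value m ∷ replicate l 1 ++ w))
            (λ x xs → eval-ζᵗ-ones m l (↓ u ⊕ 1 ⊕ value x ∷ xs))))))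
      where
      f : ℕ≥ 1 → List (ℕ≥ 1) → Pol
      f a₁ a₂⋯ = ζᵗ (m , ones l ++ ↓ u ⊕ 1 ⊕ value a₁ ∷ a₂⋯)
      p = ζᵗ (m , ones (suc l) ++ ↓ u ∷ toList a)
      q = ζᵗ (m , ones l ++ ↓ u ⊕ 1 ∷ toList a)
      r = (1ₚ -ₚ D) *ₚ (t ^ₚ 2 -ₚ t) *ₚ splitFirst a f

    merged : ℕ → ℕ → List ℕ → ℚ
    merged m u x = S (m ∷ u ∷ x) + S (u ∷ m ∷ x) + β * S (m ℕ.+ u ∷ x) + α * (m ℕ.+ u ▷ S) x

    eval-mergedTerm : ∀ m u D {N} (a : Vec (ℕ≥ 1) N) → ⟦ D ⟧ ≡ 0ℚ ⊎ N ≡ 0 →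
      ⟦ mergedTerm m u D a ⟧ ≡ merged (value m) (value u) (values a)
    eval-mergedTerm m u D a cases = trans
      (trans (eval-+ (o +ₚ p +ₚ (1ₚ -ₚ 2 ×ₚ t) *ₚ q) r) (cong (_+ ⟦ r ⟧)
        (trans (eval-+ (o +ₚ p) ((1ₚ -ₚ 2 ×ₚ t) *ₚ q)) (cong (_+ ⟦ (1ₚ -ₚ 2 ×ₚ t) *ₚ q ⟧) (eval-+ o p)))))
      (cong₂ _+_
        (cong₂ _+_ (cong₂ _+_ (eval-ζᵗ m (↓ u ∷ toList a)) (eval-ζᵗ u (↓ m ∷ toList a)))
                   (trans (eval-β* q) (cong (β *_) (eval-ζᵗ (m ⊕ value u) (toList a)))))
        (trans (eval-factor a D f cases) (cong (α *_)
          (eval-splitFirst a f (value m ℕ.+ value u) S (λ x xs → eval-ζᵗ (m ⊕ value u ⊕ value x) xs)))))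
      where
      f : ℕ≥ 1 → List (ℕ≥ 1) → Pol
      f a₁ a₂⋯ = ζᵗ (m ⊕ value u ⊕ value a₁ , a₂⋯)
      o = ζᵗ (m , ↓ u ∷ toList a)
      p = ζᵗ (u , ↓ m ∷ toList a)
      q = ζᵗ (m ⊕ value u , toList a)
      r = (1ₚ -ₚ D) *ₚ (t ^ₚ 2 -ₚ t) *ₚ splitFirst a f

    -- Here `suc l` is the summation index of the theorem. Once m, these ones and u are read, 1ᵛ and
    -- the remaining ones are left; taking 1ᵛ as first factor gives the lower binomial argument v -
    -- k.
    eval-insertionSum₁ : ∀ m u n v l → suc l ℕ.≤ n →
      ⟦ insertionSum m u (suc l) (v ℕ.⊓ (n ℕ.∸ suc l)) (v ℕ.+ n ℕ.∸ suc l) (n ℕ.+ v ℕ.∸ suc l) v (δ v 0 *ₚ δ n (suc l)) ⟧ ≡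
      stuffle (replicate v 1) (replicate (n ℕ.∸ suc l) 1) (insertion l (value u) (S ∘ (value m ∷_)))
    eval-insertionSum₁ m u n v l l<n = begin
      ⟦ insertionSum m u (suc l) (v ℕ.⊓ n′) W V v D ⟧
        ≡⟨ eval-onesProduct (v ℕ.⊓ n′) W V v (λ k ij a → insertionTerm m u (suc l) D a) F
             (λ k ij a → eval-insertionTerm m u l D a (length-cases {W} {D} (proj₁ ij) k (eval-δδ v n (suc l)))) ⟩
      onesProduct (v ℕ.⊓ n′) W V v F
        ≡⟨ cong₂ (λ W V → onesProduct (v ℕ.⊓ n′) W V v F)
             (trans (ℕ.+-∸-assoc v l<n) (ℕ.+-comm v n′))
             (trans (cong (ℕ._∸ suc l) (ℕ.+-comm n v)) (ℕ.+-∸-assoc v l<n)) ⟩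
      onesProduct (v ℕ.⊓ n′) (n′ ℕ.+ v) (v ℕ.+ n′) v F
        ≡⟨ onesProduct≡stuffle v n′ F ⟩
      stuffle (replicate v 1) (replicate n′ 1) F ∎
      where
      open ≡-Reasoning
      n′ = n ℕ.∸ suc l
      W = v ℕ.+ n ℕ.∸ suc l
      V = n ℕ.+ v ℕ.∸ suc l
      D = δ v 0 *ₚ δ n (suc l)
      F = insertion l (value u) (S ∘ (value m ∷_))

    eval-insertionSum₂ : ∀ m u n v l → suc l ℕ.≤ v →
      ⟦ insertionSum u m (suc l) (n ℕ.⊓ (v ℕ.∸ suc l)) (v ℕ.+ n ℕ.∸ suc l) (n ℕ.+ v ℕ.∸ suc l) n (δ n 0 *ₚ δ v (suc l)) ⟧ ≡
      stuffle (replicate n 1) (replicate (v ℕ.∸ suc l) 1) (insertion l (value m) (S ∘ (value u ∷_)))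
    eval-insertionSum₂ m u n v l l<v = trans
      (cong₂ (λ W V → ⟦ insertionSum u m (suc l) (n ℕ.⊓ (v ℕ.∸ suc l)) W V n (δ n 0 *ₚ δ v (suc l)) ⟧)
        (cong (ℕ._∸ suc l) (ℕ.+-comm v n)) (cong (ℕ._∸ suc l) (ℕ.+-comm n v)))
      (eval-insertionSum₁ u m v n l l<v)

    eval-mergedSum : ∀ m u n v →
      ⟦ mergedSum m u (n ℕ.⊓ v) (v ℕ.+ n) (n ℕ.+ v) n (δ n 0 *ₚ δ v 0) ⟧ ≡
      stuffle (replicate n 1) (replicate v 1) (merged (value m) (value u))
    eval-mergedSum m u n v = trans
      (eval-onesProduct (n ℕ.⊓ v) (v ℕ.+ n) (n ℕ.+ v) n (λ k ij a → mergedTerm m u D a) F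
        (λ k ij a → eval-mergedTerm m u D a (length-cases {v ℕ.+ n} {D} (proj₁ ij) k cases)))
      (onesProduct≡stuffle n v F)
      where
      D = δ n 0 *ₚ δ v 0
      F = merged (value m) (value u)
      cases : ⟦ D ⟧ ≡ 0ℚ ⊎ v ℕ.+ n ≡ 0
      cases = subst (λ k → ⟦ D ⟧ ≡ 0ℚ ⊎ k ≡ 0) (ℕ.+-comm n v) (eval-δδ n v 0)

    stuffle-merged : ∀ v w m u →
      stuffle v w (merged m u) ≡
      stuffle v w (S ∘ (m ∷_) ∘ (u ∷_)) + stuffle v w (S ∘ (u ∷_) ∘ (m ∷_)) +
      β * stuffle v w (S ∘ (m ℕ.+ u ∷_)) + α * stuffle v w (m ℕ.+ u ▷ S)
    stuffle-merged v w m u = trans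
      (stuffle-+ v w (λ x → S (m ∷ u ∷ x) + S (u ∷ m ∷ x) + β * S (m ℕ.+ u ∷ x)) (λ x → α * (m ℕ.+ u ▷ S) x))
      (cong₂ _+_
        (trans (stuffle-+ v w (λ x → S (m ∷ u ∷ x) + S (u ∷ m ∷ x)) (λ x → β * S (m ℕ.+ u ∷ x)))
          (cong₂ _+_ (stuffle-+ v w (λ x → S (m ∷ u ∷ x)) (λ x → S (u ∷ m ∷ x)))
                     (stuffle-* β v w (λ x → S (m ℕ.+ u ∷ x)))))
        (stuffle-* α v w (m ℕ.+ u ▷ S)))

    -- The first step of the product reads m, u or their merger. The boundary terms of
    -- `stuffle-ones-∷`, where m and u are adjacent in front, join the merger in `merged`.
    truncated-product : ∀ m u n v →
      S (m ∷ replicate n 1) * S (u ∷ replicate v 1) ≡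
      ∑< n (λ l → stuffle (replicate v 1) (replicate (n ℕ.∸ suc l) 1) (insertion l u (S ∘ (m ∷_)))) +
      ∑< v (λ l → stuffle (replicate n 1) (replicate (v ℕ.∸ suc l) 1) (insertion l m (S ∘ (u ∷_)))) +
      stuffle (replicate n 1) (replicate v 1) (merged m u)
    truncated-product m u n v = begin
      S (m ∷ ns) * S (u ∷ vs)
        ≡⟨ truncated-character M (m ∷ ns) (u ∷ vs) ⟩
      stuffle ns (u ∷ vs) (S ∘ (m ∷_)) + stuffle (m ∷ ns) vs (S ∘ (u ∷_)) + (β * Y + α * Z)
        ≡⟨ cong (_+ (β * Y + α * Z)) (cong₂ _+_ (stuffle-ones-∷ n u vs (S ∘ (m ∷_)))
             (trans (stuffle-comm (m ∷ ns) vs (S ∘ (u ∷_))) (stuffle-ones-∷ v m ns (S ∘ (u ∷_))))) ⟩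
      (P + stuffle ns vs (S ∘ (m ∷_) ∘ (u ∷_))) + (Q + stuffle vs ns (S ∘ (u ∷_) ∘ (m ∷_))) + (β * Y + α * Z)
        ≡⟨ cong (λ z → (P + R) + (Q + z) + (β * Y + α * Z)) (stuffle-comm vs ns (S ∘ (u ∷_) ∘ (m ∷_))) ⟩
      (P + R) + (Q + X) + (β * Y + α * Z)
        ≡⟨ solve 8 (λ b a p q r x y z → (p :+ r) :+ (q :+ x) :+ (b :* y :+ a :* z) := p :+ q :+ (r :+ x :+ b :* y :+ a :* z)) refl β α P Q R X Y Z ⟩
      P + Q + (R + X + β * Y + α * Z)
        ≡⟨ cong (λ z → P + Q + z) (stuffle-merged ns vs m u) ⟨
      P + Q + stuffle ns vs (merged m u) ∎
      where
      open ≡-Reasoning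
      ns = replicate n 1
      vs = replicate v 1
      P = ∑< n (λ l → stuffle vs (replicate (n ℕ.∸ suc l) 1) (insertion l u (S ∘ (m ∷_))))
      Q = ∑< v (λ l → stuffle ns (replicate (v ℕ.∸ suc l) 1) (insertion l m (S ∘ (u ∷_))))
      R = stuffle ns vs (S ∘ (m ∷_) ∘ (u ∷_))
      X = stuffle ns vs (S ∘ (u ∷_) ∘ (m ∷_))
      Y = stuffle ns vs (S ∘ (m ℕ.+ u ∷_))
      Z = stuffle ns vs (m ℕ.+ u ▷ S)

    eval-ζᵗ-ones′ : ∀ (k : ℕ≥ 2) n → ⟦ ζᵗ (k , ones n) ⟧ ≡ S (value k ∷ replicate n 1)
    eval-ζᵗ-ones′ k n = trans (eval-ζᵗ k (ones n)) (cong (λ w → S (value k ∷ w)) (map-replicate value n _))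

    eval-corollary : ∀ (m u : ℕ≥ 2) (n v : ℕ) →
      ⟦ ζᵗ (m , ones n) *ₚ ζᵗ (u , ones v) ⟧ ≡ ⟦ rightHandSide m u n v ⟧
    eval-corollary m u n v = begin
      ⟦ ζᵗ (m , ones n) *ₚ ζᵗ (u , ones v) ⟧
        ≡⟨ trans (eval-* (ζᵗ (m , ones n)) (ζᵗ (u , ones v))) (cong₂ _*_ (eval-ζᵗ-ones′ m n) (eval-ζᵗ-ones′ u v)) ⟩
      S (value m ∷ replicate n 1) * S (value u ∷ replicate v 1)
        ≡⟨ truncated-product (value m) (value u) n v ⟩
      ∑< n (λ l → stuffle (replicate v 1) (replicate (n ℕ.∸ suc l) 1) (insertion l (value u) (S ∘ (value m ∷_)))) +
      ∑< v (λ l → stuffle (replicate n 1) (replicate (v ℕ.∸ suc l) 1) (insertion l (value m) (S ∘ (value u ∷_)))) +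
      stuffle (replicate n 1) (replicate v 1) (merged (value m) (value u))
        ≡⟨ cong₂ _+_ (cong₂ _+_
             (trans (trans (eval-∑ (1 ⋯ n) A) (∑ℚ-⋯ 1 n (λ l → ⟦ A l ⟧))) (∑<-cong n (λ l → eval-insertionSum₁ m u n v l)))
             (trans (trans (eval-∑ (1 ⋯ v) B) (∑ℚ-⋯ 1 v (λ l → ⟦ B l ⟧))) (∑<-cong v (λ l → eval-insertionSum₂ m u n v l))))
             (eval-mergedSum m u n v) ⟨
      ⟦ ∑ (1 ⋯ n) A ⟧ + ⟦ ∑ (1 ⋯ v) B ⟧ + ⟦ E ⟧
        ≡⟨ trans (eval-+ (∑ (1 ⋯ n) A +ₚ ∑ (1 ⋯ v) B) E) (cong (_+ ⟦ E ⟧) (eval-+ (∑ (1 ⋯ n) A) (∑ (1 ⋯ v) B))) ⟨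
      ⟦ ∑ (1 ⋯ n) A +ₚ ∑ (1 ⋯ v) B +ₚ E ⟧ ∎
      where
      open ≡-Reasoning
      A B : ℕ → Pol
      A l = insertionSum m u l (v ℕ.⊓ (n ℕ.∸ l)) (v ℕ.+ n ℕ.∸ l) (n ℕ.+ v ℕ.∸ l) v (δ v 0 *ₚ δ n l)
      B l = insertionSum u m l (n ℕ.⊓ (v ℕ.∸ l)) (v ℕ.+ n ℕ.∸ l) (n ℕ.+ v ℕ.∸ l) n (δ n 0 *ₚ δ v l)
      E = mergedSum m u (n ℕ.⊓ v) (v ℕ.+ n) (n ℕ.+ v) n (δ n 0 *ₚ δ v 0)

  -- The approximants of the coefficients agree for every M, so the threshold 0 works for each ε.
  eval-injective : ∀ p q → (∀ M τ → eval M τ p ≡ eval M τ q) → p ≈ₚ q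
  eval-injective p q eq i ε 0<ε = 0 , λ M _ → subst (_< ε) (sym (cong ∣_∣ (difference M))) 0<ε
    where
    open ≡-Reasoning
    difference : ∀ M → approx (coeff p i) M - approx (coeff q i) M ≡ 0ℚ
    difference M = begin
      approx (coeff p i) M - approx (coeff q i) M             ≡⟨ cong (λ z → approx (coeff p i) M + z) (coeff-neg M q i) ⟨
      approx (coeff p i) M + approx (coeff (-ₚ q) i) M        ≡⟨ coeff-+ M p (-ₚ q) i ⟨
      approx (coeff (p -ₚ q) i) M                             ≡⟨ coeff-zero M (p -ₚ q) (λ τ _ → trans (Evaluated.eval-sub M τ p q)
                                                                   (trans (cong (_- eval M τ q) (eq M τ)) (+-inverseʳ (eval M τ q)))) i ⟩
      0ℚ                                                      ∎

  corollary : ∀ (m u : ℕ≥ 2) (n v : ℕ) → ζᵗ (m , ones n) *ₚ ζᵗ (u , ones v) ≈ₚ rightHandSide m u n v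
  corollary m u n v = eval-injective (ζᵗ (m , ones n) *ₚ ζᵗ (u , ones v)) (rightHandSide m u n v)
    (λ M τ → Evaluated.eval-corollary M τ m u n v)

open import Data.List using (_∷_; _++_)
open import Data.Nat using (ℕ; _+_; _*_; _∸_; _⊓_)
open import Data.Nat.Combinatorics using (_C_)
open import Data.Product using (_,_)
open import Data.Refinement using (value)
open import Data.Vec using (toList)

corollary1 : ∀ (m u : ℕ≥ 2) (n v : ℕ) →
  ζᵗ (m , ones n) *ₚ ζᵗ (u , ones v) ≈ₚ
    (∑[ l ← 1 ⋯ n ] ∑[ k ← 0 ⋯ (v ⊓ (n ∸ l)) ] ∑[ (i , j) ← decompositions k ]
      ∑[ a ← 𝒜 (v + n ∸ l ∸ i ∸ k) (n + v ∸ l) j ]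
        ((v + n ∸ l ∸ 2 * k) C (v ∸ k)) ×ₚ ((t ^ₚ 2 -ₚ t) ^ₚ i *ₚ (1ₚ -ₚ 2 ×ₚ t) ^ₚ j *ₚ
          ( ζᵗ (m , ones l ++ ↓ u ∷ toList a)
          +ₚ (1ₚ -ₚ 2 ×ₚ t) *ₚ ζᵗ (m , ones (l ∸ 1) ++ ↓ u ⊕ 1 ∷ toList a)
          +ₚ (1ₚ -ₚ δ v 0 *ₚ δ n l) *ₚ (t ^ₚ 2 -ₚ t) *ₚ
               splitFirst a (λ a₁ a₂⋯ → ζᵗ (m , ones (l ∸ 1) ++ ↓ u ⊕ 1 ⊕ value a₁ ∷ a₂⋯)))))
    +ₚ
    (∑[ l ← 1 ⋯ v ] ∑[ k ← 0 ⋯ (n ⊓ (v ∸ l)) ] ∑[ (i , j) ← decompositions k ]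
      ∑[ a ← 𝒜 (v + n ∸ l ∸ i ∸ k) (n + v ∸ l) j ]
        ((v + n ∸ l ∸ 2 * k) C (n ∸ k)) ×ₚ ((t ^ₚ 2 -ₚ t) ^ₚ i *ₚ (1ₚ -ₚ 2 ×ₚ t) ^ₚ j *ₚ
          ( ζᵗ (u , ones l ++ ↓ m ∷ toList a)
          +ₚ (1ₚ -ₚ 2 ×ₚ t) *ₚ ζᵗ (u , ones (l ∸ 1) ++ ↓ m ⊕ 1 ∷ toList a)
          +ₚ (1ₚ -ₚ δ n 0 *ₚ δ v l) *ₚ (t ^ₚ 2 -ₚ t) *ₚ
               splitFirst a (λ a₁ a₂⋯ → ζᵗ (u , ones (l ∸ 1) ++ ↓ m ⊕ 1 ⊕ value a₁ ∷ a₂⋯)))))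
    +ₚ
    (∑[ k ← 0 ⋯ (n ⊓ v) ] ∑[ (i , j) ← decompositions k ]
      ∑[ a ← 𝒜 (v + n ∸ i ∸ k) (n + v) j ]
        ((v + n ∸ 2 * k) C (n ∸ k)) ×ₚ ((t ^ₚ 2 -ₚ t) ^ₚ i *ₚ (1ₚ -ₚ 2 ×ₚ t) ^ₚ j *ₚ
          ( ζᵗ (m , ↓ u ∷ toList a)
          +ₚ ζᵗ (u , ↓ m ∷ toList a)
          +ₚ (1ₚ -ₚ 2 ×ₚ t) *ₚ ζᵗ (m ⊕ value u , toList a)
          +ₚ (1ₚ -ₚ δ n 0 *ₚ δ v 0) *ₚ (t ^ₚ 2 -ₚ t) *ₚ
               splitFirst a (λ a₁ a₂⋯ → ζᵗ (m ⊕ value u ⊕ value a₁ , a₂⋯)))))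
corollary1 = Proof.corollary
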